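{- For each subvariety $\mathcal{V}$ of the variety $\mathcal{WH}$ of Wajsberg hoops there are, up to equivalence over $\mathcal{V}$, only finitely many terms $t(x)$ in one variable in the language $\{\cdot,\to,\top\}$ that define multiplicative conuclei on $\mathcal{V}$.
   Context: A hoop is an algebra $\langle A,\cdot,\to,\top\rangle$ such that $\langle A,\cdot,\top\rangle$ is a commutative monoid and $x\to x=\top$, $x\cdot(x\to y)=y\cdot(y\to x)$, $x\to(y\to z)=(x\cdot y)\to z$; it is partially ordered by $x\le y$ iff $x\to y=\top$. A Wajsberg hoop is a hoop satisfying $(x\to y)\to y\approx(y\to x)\to x$. A multiplicative conucleus on a hoop $\mathbf{A}$ is a map $\delta\colon A\to A$ that is an interior operator ($\delta(a)\le a$, $\delta$ monotone, $\delta\delta=\delta$) with $\delta(a\cdot b)=\delta(a)\cdot\delta(b)$ for all $a,b$. A term $t(x)$ defines a multiplicative conucleus on a variety $\mathcal{V}$ if $t^{\mathbf{A}}$ is a multiplicative conucleus on $\mathbf{A}$ for every $\mathbf{A}\in\mathcal{V}$. Two terms $t(x),s(x)$ are equivalent over $\mathcal{V}$ if $\mathcal{V}\vDash t(x)\approx s(x)$. -}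

module Defs where

open import Level using (Level; _⊔_; suc)
open import Algebra.Structures using (IsCommutativeMonoid)
open import Algebra.Definitions using (IdempotentFun)
open import Data.Fin using (Fin)
open import Data.Nat using (ℕ)
open import Data.Product using (∃; ∃-syntax; _×_; proj₁)
open import Relation.Binary.Bundles using (Setoid)
open import Relation.Binary.Core using (Rel; _Preserves_⟶_)
open import Relation.Binary.Structures using (IsEquivalence)
import Relation.Binary.Construct.On as On
open import Relation.Unary using (Pred; _∈_; _≐_)

private
  variable
    x c ℓ e v : Level

infixr 7 _·ₜ_
infixr 6 _⇒ₜ_

data Term (X : Set x) : Set x where
  var  : X → Term X
  _·ₜ_ : Term X → Term X → Term X
  _⇒ₜ_ : Term X → Term X → Term X
  ⊤ₜ   : Term X

-- Equality in an algebra is a setoid equality, so that quotient algebras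
-- are again algebras.
record Algebra (c ℓ : Level) : Set (suc (c ⊔ ℓ)) where
  infixr 7 _·_
  infixr 6 _⇒_
  infix  4 _≈_ _≤_
  field
    Carrier       : Set c
    _≈_           : Rel Carrier ℓ
    _·_           : Carrier → Carrier → Carrier
    _⇒_           : Carrier → Carrier → Carrier
    ⊤             : Carrier
    isEquivalence : IsEquivalence _≈_
    ·-cong        : ∀ {a b a′ b′} → a ≈ a′ → b ≈ b′ → a · b ≈ a′ · b′
    ⇒-cong        : ∀ {a b a′ b′} → a ≈ a′ → b ≈ b′ → a ⇒ b ≈ a′ ⇒ b′

  _≤_ : Rel Carrier ℓ
  a ≤ b = a ⇒ b ≈ ⊤

  ⟦_⟧ : {X : Set x} → Term X → (X → Carrier) → Carrier
  ⟦ var i ⟧  ρ = ρ i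
  ⟦ s ·ₜ t ⟧ ρ = ⟦ s ⟧ ρ · ⟦ t ⟧ ρ
  ⟦ s ⇒ₜ t ⟧ ρ = ⟦ s ⟧ ρ ⇒ ⟦ t ⟧ ρ
  ⟦ ⊤ₜ ⟧     ρ = ⊤

record IsHoop (A : Algebra c ℓ) : Set (c ⊔ ℓ) where
  open Algebra A
  field
    isCommutativeMonoid : IsCommutativeMonoid _≈_ _·_ ⊤
    ⇒-refl              : ∀ a → a ⇒ a ≈ ⊤
    divisibility        : ∀ a b → a · (a ⇒ b) ≈ b · (b ⇒ a)
    currying            : ∀ a b d → a ⇒ (b ⇒ d) ≈ (a · b) ⇒ d

record IsWajsbergHoop (A : Algebra c ℓ) : Set (c ⊔ ℓ) where
  open Algebra A
  field
    isHoop  : IsHoop A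
    tanaka  : ∀ a b → (a ⇒ b) ⇒ b ≈ (b ⇒ a) ⇒ a

infix 4 _⊨_≈_ _⊫_≈_

_⊨_≈_ : {X : Set x} → Algebra c ℓ → Term X → Term X → Set (x ⊔ c ⊔ ℓ)
A ⊨ s ≈ t = ∀ ρ → ⟦ s ⟧ ρ ≈ ⟦ t ⟧ ρ
  where open Algebra A

_⊫_≈_ : {X : Set x} → Pred (Algebra c ℓ) v → Term X → Term X → Set (x ⊔ suc (c ⊔ ℓ) ⊔ v)
V ⊫ s ≈ t = ∀ A → A ∈ V → A ⊨ s ≈ t

Mod : Rel (Term ℕ) e → Pred (Algebra c ℓ) (c ⊔ ℓ ⊔ e)
Mod E A = ∀ s t → E s t → A ⊨ s ≈ t

-- A variety is an equational class; e bounds the size of the set of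
-- equations.
IsVariety : (e : Level) → Pred (Algebra c ℓ) v → Set (suc (c ⊔ ℓ ⊔ e) ⊔ v)
IsVariety e V = ∃[ E ] V ≐ Mod {e} E

record IsMultiplicativeConucleus (A : Algebra c ℓ)
                                 (δ : Algebra.Carrier A → Algebra.Carrier A) : Set (c ⊔ ℓ) where
  open Algebra A
  field
    contractive    : ∀ a → δ a ≤ a
    monotone       : δ Preserves _≤_ ⟶ _≤_
    idempotent     : IdempotentFun _≈_ δ
    multiplicative : ∀ a b → δ (a · b) ≈ δ a · δ b

UnaryTerm : Set
UnaryTerm = Term (Fin 1)

termFunction : (A : Algebra c ℓ) → UnaryTerm → Algebra.Carrier A → Algebra.Carrier A
termFunction A t a = Algebra.⟦_⟧ A t (λ _ → a)

DefinesMultiplicativeConucleus : Pred (Algebra c ℓ) v → UnaryTerm → Set (suc (c ⊔ ℓ) ⊔ v)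
DefinesMultiplicativeConucleus V t = ∀ A → A ∈ V → IsMultiplicativeConucleus A (termFunction A t)

equivalenceOver : Pred (Algebra c ℓ) v → Setoid _ _
equivalenceOver {c} {ℓ} {v} V = record
  { Carrier       = UnaryTerm
  ; _≈_           = λ t s → V ⊫ t ≈ s
  ; isEquivalence = record
    { refl  = λ A _ _ → IsEquivalence.refl (Algebra.isEquivalence A)
    ; sym   = λ t≈s A A∈V ρ → IsEquivalence.sym (Algebra.isEquivalence A) (t≈s A A∈V ρ)
    ; trans = λ t≈s s≈r A A∈V ρ →
        IsEquivalence.trans (Algebra.isEquivalence A) (t≈s A A∈V ρ) (s≈r A A∈V ρ)
    }
  }

conucleusTerms : Pred (Algebra c ℓ) v → Setoid _ _
conucleusTerms V = On.setoid {B = ∃ (DefinesMultiplicativeConucleus V)} (equivalenceOver V) proj₁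

{-# OPTIONS --safe #-}
module Submission where

-- On a totally ordered Wajsberg hoop z · e ≈ z forces e ≈ ⊤ unless z is the least
-- element.  Applied to t(x) ≈ t(x) · t(x ⇒ t(x)), this shows that a conucleus t
-- satisfies t(x) ≈ x or t(x) ≈ ⊥ at each x.  By multiplicativity, if t fixes one
-- nilpotent x > ⊥ then it is the identity, and since t(x) ≥ x ^ size t it fixes
-- every non-nilpotent x.  Hence two conuclei can only differ on a chain where one
-- is the identity and the other kills all nilpotent elements; such a chain is,
-- modulo infinitesimals, a finite Łukasiewicz chain, and which of the two cases
-- holds can be read off from the value of t at the co-atom of that Łukasiewicz
-- chain (or at the atom of Chang's MV-algebra, for the two-element chain).
--
-- If the nilpotency index of elements of chains in V is bounded, only finitely
-- many Łukasiewicz chains matter.  Otherwise t is the identity on chains with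
-- elements of large index, and approximating the co-atom of a finite Łukasiewicz
-- chain by a power of such an element shows that t fixes the co-atom, so that all
-- conuclei agree.
--
-- Chains suffice: the subalgebra generated by one element is countable, so a prime
-- filter avoiding a given element other than ⊤ is obtained without choice.

open import Defs
open import Level using (Level; _⊔_; Lift; lift; lower) renaming (suc to lsuc)
open import Algebra.Bundles using (CommutativeMonoid)
import Algebra.Properties.CommutativeMonoid.Mult as Mult
import Algebra.Properties.CommutativeSemigroup as CommutativeSemigroupProperties
open import Axiom.ExcludedMiddle using (ExcludedMiddle)
open import Data.Empty using (⊥)
open import Data.Fin using (zero)
open import Data.List using (List; []; _∷_; _++_; map; cartesianProductWith; upTo)
open import Data.List.Membership.Propositional using (_∈_)
open import Data.List.Membership.Propositional.Properties
  using (∈-++⁺ˡ; ∈-++⁺ʳ; ∈-map⁺; ∈-cartesianProductWith⁺; ∈-upTo⁺)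
open import Data.List.Relation.Unary.All as All using (All; []; _∷_)
open import Data.List.Relation.Unary.Any using (Any; here; there)
import Data.List.Relation.Unary.Any.Properties as Any
open import Data.List.Relation.Unary.Enumerates.Setoid using (IsEnumeration)
open import Data.Nat as ℕ using (ℕ; zero; suc; z≤n; s≤s)
import Data.Nat.Properties as ℕ
open import Data.Product as Product using (∃; ∃-syntax; Σ-syntax; _×_; _,_; proj₁; proj₂)
open import Data.Sum as Sum using (_⊎_; inj₁; inj₂)
open import Data.Unit using (tt) renaming (⊤ to Unit)
open import Function using (_∘_; id)
open import Relation.Binary.Bundles using (Poset; Setoid)
import Relation.Binary.Construct.On as On
open import Relation.Binary.Core using (Rel)
import Relation.Binary.Reasoning.PartialOrder as PartialOrderReasoning
open import Relation.Binary.Structures using (IsEquivalence)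
open import Relation.Binary.PropositionalEquality using (_≡_)
import Relation.Binary.PropositionalEquality as ≡
open import Relation.Nullary using (¬_; yes; no; contradiction)
open import Relation.Nullary.Decidable using (decidable-stable)
open import Relation.Unary using (Pred; _⊆_)

-- Order, residuation and powers in hoops.

size : UnaryTerm → ℕ
size (var _)  = 1
size (s ·ₜ t) = suc (size s ℕ.+ size t)
size (s ⇒ₜ t) = suc (size s ℕ.+ size t)
size ⊤ₜ       = 1

module HoopProperties {c ℓ : Level} (A : Algebra c ℓ) (isHoop : IsHoop A) where

  open Algebra A
  open IsHoop isHoop

  commutativeMonoid : CommutativeMonoid c ℓ
  commutativeMonoid = record { isCommutativeMonoid = isCommutativeMonoid }

  open CommutativeMonoid commutativeMonoid public
    using (refl; sym; trans; assoc; comm; identityˡ; identityʳ; commutativeSemigroup; setoid)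
  open CommutativeSemigroupProperties commutativeSemigroup public
    using (interchange; xy∙z≈xz∙y)
  private module Multiples = Mult commutativeMonoid

  private
    -- This precedes `≤⊤`, which is not an axiom. Divisibility against ⊤ gives `⊤ ⇒ a ≈ a · e`,
    -- while `a ⇒ (⊤ ⇒ a)` is ⊤ by currying; divisibility for `a` and `⊤ ⇒ a` then rewrites `a` into
    -- `a · e`.
    a·⟨a⇒⊤⟩≈a : ∀ a → a · (a ⇒ ⊤) ≈ a
    a·⟨a⇒⊤⟩≈a a = sym (begin
      a                                ≈⟨ identityʳ a ⟨
      a · ⊤                            ≈⟨ ·-cong refl (trans (currying a ⊤ a) (trans (⇒-cong (identityʳ a) refl) (⇒-refl a))) ⟨
      a · (a ⇒ (⊤ ⇒ a))                ≈⟨ divisibility a (⊤ ⇒ a) ⟩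
      (⊤ ⇒ a) · ((⊤ ⇒ a) ⇒ a)          ≈⟨ ·-cong ⊤⇒a≈ (⇒-cong ⊤⇒a≈ refl) ⟩
      (a · e) · ((a · e) ⇒ a)          ≈⟨ ·-cong refl (⇒-cong (comm a e) refl) ⟩
      (a · e) · ((e · a) ⇒ a)          ≈⟨ ·-cong refl (currying e a a) ⟨
      (a · e) · (e ⇒ (a ⇒ a))          ≈⟨ ·-cong refl (⇒-cong refl (⇒-refl a)) ⟩
      (a · e) · (e ⇒ ⊤)                ≈⟨ assoc a e (e ⇒ ⊤) ⟩
      a · (e · (e ⇒ ⊤))                ≈⟨ ·-cong refl (divisibility e ⊤) ⟩
      a · (⊤ · (⊤ ⇒ e))                ≈⟨ ·-cong refl (identityˡ (⊤ ⇒ e)) ⟩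
      a · (⊤ ⇒ (a ⇒ ⊤))                ≈⟨ ·-cong refl (currying ⊤ a ⊤) ⟩
      a · ((⊤ · a) ⇒ ⊤)                ≈⟨ ·-cong refl (⇒-cong (identityˡ a) refl) ⟩
      a · e                            ∎)
      where
      open import Relation.Binary.Reasoning.Setoid setoid
      e = a ⇒ ⊤
      ⊤⇒a≈ : ⊤ ⇒ a ≈ a · e
      ⊤⇒a≈ = trans (sym (identityˡ (⊤ ⇒ a))) (divisibility ⊤ a)

  ⊤-identityˡ-⇒ : ∀ a → ⊤ ⇒ a ≈ a
  ⊤-identityˡ-⇒ a =
    trans (sym (identityˡ (⊤ ⇒ a))) (trans (divisibility ⊤ a) (a·⟨a⇒⊤⟩≈a a))

  ≤⊤ : ∀ a → a ≤ ⊤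
  ≤⊤ a = sym (trans (sym (⇒-refl (a ⇒ ⊤)))
    (trans (currying (a ⇒ ⊤) a ⊤) (⇒-cong (trans (comm _ a) (a·⟨a⇒⊤⟩≈a a)) refl)))

  ≤-reflexive : ∀ {a b} → a ≈ b → a ≤ b
  ≤-reflexive a≈b = trans (⇒-cong a≈b refl) (⇒-refl _)

  ≤-refl : ∀ {a} → a ≤ a
  ≤-refl = ⇒-refl _

  b≤a⇒a·⟨a⇒b⟩≈b : ∀ {a b} → b ≤ a → a · (a ⇒ b) ≈ b
  b≤a⇒a·⟨a⇒b⟩≈b {a} {b} b≤a =
    trans (divisibility a b) (trans (·-cong refl b≤a) (identityʳ b))

  ≤-trans : ∀ {a b d} → a ≤ b → b ≤ d → a ≤ d
  ≤-trans {a} {b} {d} a≤b b≤d =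
    trans (⇒-cong (trans (sym (b≤a⇒a·⟨a⇒b⟩≈b a≤b)) (comm b (b ⇒ a))) refl)
    (trans (sym (currying (b ⇒ a) b d)) (trans (⇒-cong refl b≤d) (≤⊤ _)))

  ≤-antisym : ∀ {a b} → a ≤ b → b ≤ a → a ≈ b
  ≤-antisym {a} {b} a≤b b≤a = trans (sym (b≤a⇒a·⟨a⇒b⟩≈b a≤b))
    (trans (·-cong refl b≤a) (identityʳ b))

  poset : Poset c ℓ ℓ
  poset = record
    { isPartialOrder = record
      { isPreorder = record
        { isEquivalence = isEquivalence
        ; reflexive     = ≤-reflexive
        ; trans         = ≤-trans
        }
      ; antisym = ≤-antisym
      }
    }

  module ≤-Reasoning = PartialOrderReasoning poset

  residuate : ∀ {a b d} → a · b ≤ d → a ≤ b ⇒ d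
  residuate = trans (currying _ _ _)

  unresiduate : ∀ {a b d} → a ≤ b ⇒ d → a · b ≤ d
  unresiduate = trans (sym (currying _ _ _))

  ⇒-monoʳ : ∀ {a b d} → b ≤ d → a ⇒ b ≤ a ⇒ d
  ⇒-monoʳ b≤d = residuate (≤-trans (unresiduate ≤-refl) b≤d)

  ·-monoˡ : ∀ {a b d} → a ≤ b → a · d ≤ b · d
  ·-monoˡ a≤b = unresiduate (≤-trans a≤b (residuate ≤-refl))

  ·-mono : ∀ {a b a′ b′} → a ≤ a′ → b ≤ b′ → a · b ≤ a′ · b′
  ·-mono {a} {b} {a′} {b′} a≤a′ b≤b′ = begin
    a · b   ≤⟨ ·-monoˡ a≤a′ ⟩
    a′ · b  ≈⟨ comm a′ b ⟩
    b · a′  ≤⟨ ·-monoˡ b≤b′ ⟩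
    b′ · a′ ≈⟨ comm b′ a′ ⟩
    a′ · b′ ∎
    where open ≤-Reasoning

  ⟨a⇒b⟩·a≤b : ∀ a b → (a ⇒ b) · a ≤ b
  ⟨a⇒b⟩·a≤b a b = unresiduate ≤-refl

  a·⟨a⇒b⟩≤b : ∀ a b → a · (a ⇒ b) ≤ b
  a·⟨a⇒b⟩≤b a b = ≤-trans (≤-reflexive (comm _ _)) (⟨a⇒b⟩·a≤b a b)

  ⇒-antiˡ : ∀ {a b d} → a ≤ b → b ⇒ d ≤ a ⇒ d
  ⇒-antiˡ a≤b = residuate (≤-trans (·-mono ≤-refl a≤b) (⟨a⇒b⟩·a≤b _ _))

  a·b≤a : ∀ a b → a · b ≤ a
  a·b≤a a b = ≤-trans (·-mono ≤-refl (≤⊤ b)) (≤-reflexive (identityʳ a))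

  a·b≤b : ∀ a b → a · b ≤ b
  a·b≤b a b = ≤-trans (≤-reflexive (comm a b)) (a·b≤a b a)

  b≤a⇒b : ∀ {a b} → b ≤ a ⇒ b
  b≤a⇒b = residuate (a·b≤a _ _)

  ⊤≤⇒≤ : ∀ {a b} → ⊤ ≤ a ⇒ b → a ≤ b
  ⊤≤⇒≤ ⊤≤ = ≤-antisym (≤⊤ _) ⊤≤

  ≤⇒⊤≤ : ∀ {a b} → a ≤ b → ⊤ ≤ a ⇒ b
  ≤⇒⊤≤ a≤b = ≤-reflexive (sym a≤b)

  infixr 8 _^_
  _^_ : Carrier → ℕ → Carrier
  a ^ n = n Multiples.× a

  ^-+ : ∀ a m n → a ^ (m ℕ.+ n) ≈ a ^ m · a ^ n
  ^-+ = Multiples.×-homo-+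

  ^-* : ∀ a m n → (a ^ n) ^ m ≈ a ^ (m ℕ.* n)
  ^-* = Multiples.×-assocˡ

  ^-1 : ∀ a → a ^ 1 ≈ a
  ^-1 = Multiples.×-homo-1

  ^-≡ : ∀ a {m n} → m ≡ n → a ^ m ≈ a ^ n
  ^-≡ a = Multiples.×-congˡ

  ^-monoˡ : ∀ n {a b} → a ≤ b → a ^ n ≤ b ^ n
  ^-monoˡ zero    a≤b = ≤-refl
  ^-monoˡ (suc n) a≤b = ·-mono a≤b (^-monoˡ n a≤b)

  ^-anti : ∀ a {m n} → m ℕ.≤ n → a ^ n ≤ a ^ m
  ^-anti a z≤n       = ≤⊤ _
  ^-anti a (s≤s m≤n) = ·-mono ≤-refl (^-anti a m≤n)

  ⊤-^ : ∀ n → ⊤ ≤ ⊤ ^ n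
  ⊤-^ zero    = ≤-refl
  ⊤-^ (suc n) = ≤-trans (⊤-^ n) (≤-reflexive (sym (identityˡ _)))

  -- A product needs the exponents of both factors, and an implication lies above its conclusion.
  -- Consequently a term can only send `x` to the minimum if `x ^ size t` is minimal.
  x^size≤ : ∀ t x → x ^ size t ≤ termFunction A t x
  x^size≤ (var _)  x = ≤-reflexive (^-1 x)
  x^size≤ (s ·ₜ t) x = begin
    x · x ^ (size s ℕ.+ size t)               ≤⟨ a·b≤b x _ ⟩
    x ^ (size s ℕ.+ size t)                   ≈⟨ ^-+ x (size s) (size t) ⟩
    x ^ size s · x ^ size t                   ≤⟨ ·-mono (x^size≤ s x) (x^size≤ t x) ⟩
    termFunction A s x · termFunction A t x   ∎
    where open ≤-Reasoning
  x^size≤ (s ⇒ₜ t) x = begin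
    x ^ suc (size s ℕ.+ size t)               ≤⟨ ^-anti x (ℕ.m≤n⇒m≤1+n (ℕ.m≤n+m (size t) (size s))) ⟩
    x ^ size t                                ≤⟨ x^size≤ t x ⟩
    termFunction A t x                        ≤⟨ b≤a⇒b ⟩
    termFunction A s x ⇒ termFunction A t x   ∎
    where open ≤-Reasoning
  x^size≤ ⊤ₜ       x = ≤⊤ _

-- Joins and prelinearity in Wajsberg hoops.

module WajsbergHoopProperties {c ℓ : Level} (A : Algebra c ℓ) (isWajsbergHoop : IsWajsbergHoop A) where

  open Algebra A
  open IsWajsbergHoop isWajsbergHoop
  open IsHoop isHoop using (currying)
  open HoopProperties A isHoop public

  a≤⟨a⇒b⟩⇒b : ∀ a b → a ≤ (a ⇒ b) ⇒ b
  a≤⟨a⇒b⟩⇒b a b = residuate (a·⟨a⇒b⟩≤b a b)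

  ⟨⟨a⇒b⟩⇒b⟩⇒b≈a⇒b : ∀ a b → ((a ⇒ b) ⇒ b) ⇒ b ≈ a ⇒ b
  ⟨⟨a⇒b⟩⇒b⟩⇒b≈a⇒b a b = ≤-antisym (⇒-antiˡ (a≤⟨a⇒b⟩⇒b a b)) (a≤⟨a⇒b⟩⇒b (a ⇒ b) b)

  b≤a⇒⟨a⇒b⟩⇒b≈a : ∀ {a b} → b ≤ a → (a ⇒ b) ⇒ b ≈ a
  b≤a⇒⟨a⇒b⟩⇒b≈a {a} {b} b≤a =
    trans (tanaka a b) (trans (⇒-cong b≤a refl) (⊤-identityˡ-⇒ a))

  -- Applying the antitone map `_⇒ b` twice to `a ≤ d` gives a bound that equals `d` by `tanaka`. So
  -- `(a ⇒ b) ⇒ b` is the join of `a` and `b`.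
  ⟨a⇒b⟩⇒b-least : ∀ {a b d} → a ≤ d → b ≤ d → (a ⇒ b) ⇒ b ≤ d
  ⟨a⇒b⟩⇒b-least a≤d b≤d =
    ≤-trans (⇒-antiˡ (⇒-antiˡ a≤d)) (≤-reflexive (b≤a⇒⟨a⇒b⟩⇒b≈a b≤d))

  -- With j = a ∨ b one has a ⇒ b ≈ j ⇒ b, b ⇒ a ≈ j ⇒ a and b ≈ (a ⇒ b) · j,
  -- hence (a ⇒ b) ⇒ (b ⇒ a) ≈ b ⇒ a, which says that the join of a ⇒ b and
  -- b ⇒ a is ⊤.
  prelinearity : ∀ a b {d} → a ⇒ b ≤ d → b ⇒ a ≤ d → ⊤ ≤ d
  prelinearity a b {d} p≤d q≤d = ≤-trans (≤⇒⊤≤ (≤-reflexive p⇒q≈q)) (⟨a⇒b⟩⇒b-least p≤d q≤d)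
    where
    j = (a ⇒ b) ⇒ b
    q≈j⇒a : b ⇒ a ≈ j ⇒ a
    q≈j⇒a = sym (trans (⇒-cong (tanaka a b) refl) (⟨⟨a⇒b⟩⇒b⟩⇒b≈a⇒b b a))
    p·j≈b : (a ⇒ b) · j ≈ b
    p·j≈b = b≤a⇒a·⟨a⇒b⟩≈b b≤a⇒b
    p⇒q≈q : (a ⇒ b) ⇒ (b ⇒ a) ≈ b ⇒ a
    p⇒q≈q = trans (⇒-cong refl q≈j⇒a) (trans (currying _ j a) (⇒-cong p·j≈b refl))

  private
    -- The hypothesis says that `p` and `q` have join ⊤. In the inductive step `p` and `q ^ n` both
    -- lie below `q ⇒ d`, which is therefore ⊤, so that `q ≤ d`.
    coprime-^ : ∀ {p q} → (∀ {d} → p ≤ d → q ≤ d → ⊤ ≤ d) →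
                ∀ n {d} → p ≤ d → q ^ n ≤ d → ⊤ ≤ d
    coprime-^ p∨q≈⊤ zero    p≤d qⁿ≤d = qⁿ≤d
    coprime-^ p∨q≈⊤ (suc n) p≤d qⁿ≤d = p∨q≈⊤ p≤d
      (⊤≤⇒≤ (coprime-^ p∨q≈⊤ n (≤-trans p≤d b≤a⇒b) (residuate (≤-trans (≤-reflexive (comm _ _)) qⁿ≤d))))

  -- Generating a filter by an element brings in its powers, so this is the form of prelinearity
  -- that prime filters require.
  prelinearity-^ : ∀ a b m n {d} → (a ⇒ b) ^ m ≤ d → (b ⇒ a) ^ n ≤ d → ⊤ ≤ d
  prelinearity-^ a b zero    n pᵐ≤d qⁿ≤d = pᵐ≤d
  prelinearity-^ a b (suc m) n pᵐ≤d qⁿ≤d = prelinearity-^ a b m n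
    (⊤≤⇒≤ (coprime-^ (prelinearity a b) n (residuate pᵐ≤d) (≤-trans qⁿ≤d b≤a⇒b))) qⁿ≤d

-- Reference algebras: finite Łukasiewicz chains and Chang's MV-algebra.

-- The value of a term at the co-atom of the Łukasiewicz chain with r + 1
-- elements, where i stands for the truth value 1 − i / r.
evalŁ : ℕ → UnaryTerm → ℕ
evalŁ r (var _)  = 1
evalŁ r (s ·ₜ t) = r ℕ.⊓ (evalŁ r s ℕ.+ evalŁ r t)
evalŁ r (s ⇒ₜ t) = evalŁ r t ℕ.∸ evalŁ r s
evalŁ r ⊤ₜ       = 0

evalŁ≤ : ∀ r t → evalŁ (suc r) t ℕ.≤ suc r
evalŁ≤ r (var _)  = s≤s z≤n
evalŁ≤ r (s ·ₜ t) = ℕ.m⊓n≤m (suc r) _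
evalŁ≤ r (s ⇒ₜ t) = ℕ.≤-trans (ℕ.m∸n≤m _ (evalŁ (suc r) s)) (evalŁ≤ r t)
evalŁ≤ r ⊤ₜ       = z≤n

-- Chang's MV-algebra: pos i is the i-th power of the co-atom, neg i its negation.
data Chang : Set where
  pos neg : ℕ → Chang

_·ᶜ_ : Chang → Chang → Chang
pos i ·ᶜ pos j = pos (i ℕ.+ j)
pos i ·ᶜ neg j = neg (j ℕ.∸ i)
neg i ·ᶜ pos j = neg (i ℕ.∸ j)
neg i ·ᶜ neg j = neg 0

_⇒ᶜ_ : Chang → Chang → Chang
pos i ⇒ᶜ pos j = pos (j ℕ.∸ i)
pos i ⇒ᶜ neg j = neg (i ℕ.+ j)
neg i ⇒ᶜ pos j = pos 0
neg i ⇒ᶜ neg j = pos (i ℕ.∸ j)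

-- The variable goes to the atom, a nilpotent element other than the bottom `neg 0`; there the
-- identity and a map killing all nilpotents differ.
evalC : UnaryTerm → Chang
evalC (var _)  = neg 1
evalC (s ·ₜ t) = evalC s ·ᶜ evalC t
evalC (s ⇒ₜ t) = evalC s ⇒ᶜ evalC t
evalC ⊤ₜ       = pos 0

-- The distance from the top or the bottom. It tells which power of a would-be co-atom must be
-- non-minimal for a computation in a chain to follow Chang's algebra.
∣_∣ᶜ : Chang → ℕ
∣ pos i ∣ᶜ = i
∣ neg i ∣ᶜ = i

∣·∣ᶜ : ∀ a b → ∣ a ·ᶜ b ∣ᶜ ℕ.≤ ∣ a ∣ᶜ ℕ.+ ∣ b ∣ᶜ
∣·∣ᶜ (pos i) (pos j) = ℕ.≤-refl
∣·∣ᶜ (pos i) (neg j) = ℕ.≤-trans (ℕ.m∸n≤m j i) (ℕ.m≤n+m j i)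
∣·∣ᶜ (neg i) (pos j) = ℕ.≤-trans (ℕ.m∸n≤m i j) (ℕ.m≤m+n i j)
∣·∣ᶜ (neg i) (neg j) = z≤n

∣⇒∣ᶜ : ∀ a b → ∣ a ⇒ᶜ b ∣ᶜ ℕ.≤ ∣ a ∣ᶜ ℕ.+ ∣ b ∣ᶜ
∣⇒∣ᶜ (pos i) (pos j) = ℕ.≤-trans (ℕ.m∸n≤m j i) (ℕ.m≤n+m j i)
∣⇒∣ᶜ (pos i) (neg j) = ℕ.≤-refl
∣⇒∣ᶜ (neg i) (pos j) = z≤n
∣⇒∣ᶜ (neg i) (neg j) = ℕ.≤-trans (ℕ.m∸n≤m i j) (ℕ.m≤m+n i j)

∣evalC∣≤size : ∀ t → ∣ evalC t ∣ᶜ ℕ.≤ size t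
∣evalC∣≤size (var _)  = ℕ.≤-refl
∣evalC∣≤size (s ·ₜ t) = ℕ.≤-trans (∣·∣ᶜ (evalC s) (evalC t))
  (ℕ.m≤n⇒m≤1+n (ℕ.+-mono-≤ (∣evalC∣≤size s) (∣evalC∣≤size t)))
∣evalC∣≤size (s ⇒ₜ t) = ℕ.≤-trans (∣⇒∣ᶜ (evalC s) (evalC t))
  (ℕ.m≤n⇒m≤1+n (ℕ.+-mono-≤ (∣evalC∣≤size s) (∣evalC∣≤size t)))
∣evalC∣≤size ⊤ₜ       = z≤n

-- Cancellation in totally ordered Wajsberg hoops.

Total : {c ℓ : Level} → Algebra c ℓ → Set (c ⊔ ℓ)
Total A = ∀ a b → a ≤ b ⊎ b ≤ a
  where open Algebra A

module WajsbergChain (em : ∀ {a : Level} → ExcludedMiddle a) {c ℓ : Level} (A : Algebra c ℓ)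
                     (isWajsbergHoop : IsWajsbergHoop A) (total : Total A) where

  open Algebra A
  open IsWajsbergHoop isWajsbergHoop
  open IsHoop isHoop using (currying)
  open WajsbergHoopProperties A isWajsbergHoop public

  -- Hoops have no constant for a least element, and a chain need not have one, so being least is a
  -- property of elements.
  IsMin : Carrier → Set (c ⊔ ℓ)
  IsMin z = ∀ y → z ≤ y

  Nilpotent : Carrier → Set (c ⊔ ℓ)
  Nilpotent x = ∃[ n ] IsMin (x ^ n)

  IsMin-down : ∀ {y z} → y ≤ z → IsMin z → IsMin y
  IsMin-down y≤z min v = ≤-trans y≤z (min v)

  ≰⇒≥ : ∀ {a b} → ¬ (a ≤ b) → b ≤ a
  ≰⇒≥ {a} {b} a≰b with total a b
  ... | inj₁ a≤b = contradiction a≤b a≰b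
  ... | inj₂ b≤a = b≤a

  -- If z ≈ z · e then e ⇒ u ≈ u for u = z ⇒ y, that is, e ∨ u ≈ ⊤.
  ≤·⇒⊤≤ : ∀ {z e} → ¬ IsMin z → z ≤ z · e → ⊤ ≤ e
  ≤·⇒⊤≤ {z} {e} z≉⊥ z≤z·e with em {P = ⊤ ≤ e}
  ... | yes ⊤≤e = ⊤≤e
  ... | no  ⊤≰e = contradiction below z≉⊥
    where
    below : IsMin z
    below y with total e (z ⇒ y)
    ... | inj₁ e≤u = ≤-trans (≤-trans z≤z·e (≤-reflexive (comm z e))) (≤-trans (·-mono e≤u ≤-refl) (⟨a⇒b⟩·a≤b z y))
    ... | inj₂ u≤e = contradiction
      (≤-trans (≤⇒⊤≤ e⇒u≤u) (≤-reflexive (b≤a⇒⟨a⇒b⟩⇒b≈a u≤e))) ⊤≰e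
      where
      e⇒u≤u : e ⇒ (z ⇒ y) ≤ z ⇒ y
      e⇒u≤u = residuate (begin
        (e ⇒ (z ⇒ y)) · z         ≤⟨ ·-mono ≤-refl (≤-trans z≤z·e (≤-reflexive (comm z e))) ⟩
        (e ⇒ (z ⇒ y)) · (e · z)   ≈⟨ assoc _ e z ⟨
        ((e ⇒ (z ⇒ y)) · e) · z   ≤⟨ ·-monoˡ (⟨a⇒b⟩·a≤b e (z ⇒ y)) ⟩
        (z ⇒ y) · z               ≤⟨ ⟨a⇒b⟩·a≤b z y ⟩
        y                         ∎)
        where open ≤-Reasoning

  -- If `d ≤ b`, then `d` is `b · (b ⇒ d)`, so `a · b` absorbs `b ⇒ d`, and `≤·⇒⊤≤` makes this
  -- factor ⊤.
  ·-cancelˡ : ∀ {a b d} → ¬ IsMin (a · b) → a · b ≤ a · d → b ≤ d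
  ·-cancelˡ {a} {b} {d} ab≉⊥ ab≤ad with total b d
  ... | inj₁ b≤d = b≤d
  ... | inj₂ d≤b = ⊤≤⇒≤ (≤·⇒⊤≤ ab≉⊥ (begin
    a · b               ≤⟨ ab≤ad ⟩
    a · d               ≈⟨ ·-cong refl (b≤a⇒a·⟨a⇒b⟩≈b d≤b) ⟨
    a · (b · (b ⇒ d))   ≈⟨ assoc a b _ ⟨
    (a · b) · (b ⇒ d)   ∎))
    where open ≤-Reasoning

  ^-≉⊥ : ∀ {x m n} → m ℕ.≤ n → ¬ IsMin (x ^ n) → ¬ IsMin (x ^ m)
  ^-≉⊥ {x} m≤n xⁿ≉⊥ min = xⁿ≉⊥ (IsMin-down (^-anti x m≤n) min)

  base-≉⊥ : ∀ x n → ¬ IsMin (x ^ suc n) → ¬ IsMin x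
  base-≉⊥ x n xⁿ⁺¹≉⊥ min = xⁿ⁺¹≉⊥ (IsMin-down (a·b≤a x _) min)

  square-≉⊥ : ∀ x n → ¬ IsMin (x ^ (2 ℕ.+ n)) → ¬ IsMin (x · x)
  square-≉⊥ x n xⁿ⁺²≉⊥ min = xⁿ⁺²≉⊥ (IsMin-down (·-mono ≤-refl (a·b≤a x _)) min)

  Nilpotent-down : ∀ {x y} → x ≤ y → Nilpotent y → Nilpotent x
  Nilpotent-down x≤y (n , min) = n , IsMin-down (^-monoˡ n x≤y) min

  Nilpotent-^ : ∀ {x} m → Nilpotent (x ^ m) → Nilpotent x
  Nilpotent-^ {x} m (n , min) = n ℕ.* m , IsMin-down (≤-reflexive (sym (^-* x n m))) min

  -- Conuclei on a chain.

  module Conucleus (t : UnaryTerm) (isConucleus : IsMultiplicativeConucleus A (termFunction A t)) where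

    open IsMultiplicativeConucleus isConucleus

    private
      δ = termFunction A t

    -- Since `δ` is idempotent and multiplicative, `δ x` absorbs `δ (x ⇒ δ x)`. That factor is then
    -- ⊤, and contractivity passes this on to `x ⇒ δ x`.
    ≉⊥⇒fixed : ∀ {x} → ¬ IsMin (δ x) → x ≤ δ x
    ≉⊥⇒fixed {x} δx≉⊥ = ⊤≤⇒≤ (≤-trans (≤·⇒⊤≤ δx≉⊥ (begin
      δ x                 ≈⟨ idempotent x ⟨
      δ (δ x)             ≤⟨ monotone (≤-reflexive (sym (b≤a⇒a·⟨a⇒b⟩≈b (contractive x)))) ⟩
      δ (x · (x ⇒ δ x))   ≈⟨ multiplicative x _ ⟩
      δ x · δ (x ⇒ δ x)   ∎)) (contractive _))
      where open ≤-Reasoning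

    ^size≉⊥⇒fixed : ∀ {x} → ¬ IsMin (x ^ size t) → x ≤ δ x
    ^size≉⊥⇒fixed {x} xᵏ≉⊥ = ≉⊥⇒fixed (xᵏ≉⊥ ∘ IsMin-down (x^size≤ t x))

    ⊤≤⇒fixed : ∀ {x} → ⊤ ≤ x → x ≤ δ x
    ⊤≤⇒fixed {x} ⊤≤x = ≤-trans (≤⊤ x)
      (≤-trans (⊤-^ (size t)) (≤-trans (^-monoˡ (size t) ⊤≤x) (x^size≤ t x)))

    -- Every `x` lies above some power of the nilpotent `y`; induct on the exponent. If `y ≤ x`,
    -- then `δ x` is above `y` and so not minimal. Otherwise `x` is `y · (y ⇒ x)`, where `y ⇒ x`
    -- lies above the preceding power.
    fixes-all : ∀ {y} → Nilpotent y → ¬ IsMin y → y ≤ δ y → ∀ x → x ≤ δ x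
    fixes-all {y} (n , yⁿ≈⊥) y≉⊥ y≤δy x = above n x (yⁿ≈⊥ x)
      where
      above : ∀ n x → y ^ n ≤ x → x ≤ δ x
      above zero    x ⊤≤x = ⊤≤⇒fixed ⊤≤x
      above (suc n) x yⁿ⁺¹≤x with total y x
      ... | inj₁ y≤x = ≉⊥⇒fixed (λ min → y≉⊥ (IsMin-down (≤-trans y≤δy (monotone y≤x)) min))
      ... | inj₂ x≤y = begin
        x                   ≈⟨ b≤a⇒a·⟨a⇒b⟩≈b x≤y ⟨
        y · (y ⇒ x)         ≤⟨ ·-mono y≤δy (above n (y ⇒ x) (residuate (≤-trans (≤-reflexive (comm _ y)) yⁿ⁺¹≤x))) ⟩
        δ y · δ (y ⇒ x)     ≈⟨ multiplicative y _ ⟨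
        δ (y · (y ⇒ x))     ≤⟨ monotone (≤-reflexive (b≤a⇒a·⟨a⇒b⟩≈b x≤y)) ⟩
        δ x                 ∎
        where open ≤-Reasoning

  -- Approximate Łukasiewicz chains inside a chain.

  -- Modulo the filter generated by u, the element y generates a copy of the
  -- Łukasiewicz chain with r + 2 elements, y ^ i playing the role of 1 − i / (r + 1).
  module Approximation (y u : Carrier) (r : ℕ)
    (yʳ≉⊥ : ¬ IsMin (y ^ r)) (yʳ⁺¹·u≈⊥ : IsMin (y ^ suc r · u))
    (step : (y ^ r ⇒ y ^ suc r) · u ≤ y) where

    private
      R = suc r
      E = evalŁ R

      ^·^ : ∀ {a b} m n → a · u ^ m ≤ b → ∀ {a′ b′} → a′ · u ^ n ≤ b′ →
            (a · a′) · u ^ suc (m ℕ.+ n) ≤ (b · b′) · u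
      ^·^ {a} {b} m n p {a′} {b′} q = begin
        (a · a′) · (u · u ^ (m ℕ.+ n))         ≈⟨ ·-cong refl (trans (comm u _) (·-cong (^-+ u m n) refl)) ⟩
        (a · a′) · ((u ^ m · u ^ n) · u)       ≈⟨ assoc _ _ u ⟨
        ((a · a′) · (u ^ m · u ^ n)) · u       ≈⟨ ·-cong (interchange a a′ (u ^ m) (u ^ n)) refl ⟩
        ((a · u ^ m) · (a′ · u ^ n)) · u       ≤⟨ ·-monoˡ (·-mono p q) ⟩
        (b · b′) · u                           ∎
        where open ≤-Reasoning

      -- Multiplying by `y ^ (r ∸ m)` turns an implication between consecutive powers at `m` into
      -- one at `r`, where `step` applies.
      step≤ : ∀ {m} → m ℕ.≤ r → (y ^ m ⇒ y ^ suc m) · u ≤ y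
      step≤ {m} m≤r = ≤-trans (·-monoˡ (residuate (begin
        (y ^ m ⇒ y ^ suc m) · y ^ r                     ≈⟨ ·-cong refl split ⟩
        (y ^ m ⇒ y ^ suc m) · (y ^ m · y ^ (r ℕ.∸ m))   ≈⟨ assoc _ _ _ ⟨
        ((y ^ m ⇒ y ^ suc m) · y ^ m) · y ^ (r ℕ.∸ m)   ≤⟨ ·-monoˡ (⟨a⇒b⟩·a≤b _ _) ⟩
        y ^ suc m · y ^ (r ℕ.∸ m)                       ≈⟨ assoc y _ _ ⟩
        y · (y ^ m · y ^ (r ℕ.∸ m))                     ≈⟨ ·-cong refl split ⟨
        y ^ suc r                                       ∎))) step
        where
        open ≤-Reasoning
        split : y ^ r ≈ y ^ m · y ^ (r ℕ.∸ m)
        split = trans (^-≡ y (≡.sym (ℕ.m+[n∸m]≡n m≤r))) (^-+ y m _)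

      -- If `y ^ d` is already below the implication `v`, then `y ^ (d + a)` absorbs `y`, so `y` is
      -- ⊤ and the bound is trivial. Otherwise `v` is `y ^ d · (y ^ d ⇒ v)`, and the second factor
      -- is an implication between consecutive powers, bounded by `step≤`.
      ⇒-^ : ∀ a d → a ℕ.+ d ℕ.≤ R → (y ^ a ⇒ y ^ (a ℕ.+ d)) · u ≤ y ^ d
      ⇒-^ a zero    _ = ≤⊤ _
      ⇒-^ a (suc d) a+1+d≤R with em {P = y ^ d ≤ y ^ a ⇒ y ^ (a ℕ.+ suc d)}
      ... | yes yᵈ≤v = ≤-trans (≤⊤ _) (≤-trans (⊤-^ (suc d)) (^-monoˡ (suc d) ⊤≤y))
        where
        b≤r : d ℕ.+ a ℕ.≤ r
        b≤r = ℕ.s≤s⁻¹ (≡.subst (ℕ._≤ R) (≡.trans (ℕ.+-suc a d) (≡.cong suc (ℕ.+-comm a d))) a+1+d≤R)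
        ⊤≤y : ⊤ ≤ y
        ⊤≤y = ≤·⇒⊤≤ (^-≉⊥ b≤r yʳ≉⊥) (begin
          y ^ (d ℕ.+ a)       ≈⟨ ^-+ y d a ⟩
          y ^ d · y ^ a       ≤⟨ unresiduate yᵈ≤v ⟩
          y ^ (a ℕ.+ suc d)   ≈⟨ ^-≡ y (≡.trans (ℕ.+-suc a d) (≡.cong suc (ℕ.+-comm a d))) ⟩
          y · y ^ (d ℕ.+ a)   ≈⟨ comm y _ ⟩
          y ^ (d ℕ.+ a) · y   ∎)
          where open ≤-Reasoning
      ... | no  yᵈ≰v = begin
        v · u                     ≈⟨ ·-cong (b≤a⇒a·⟨a⇒b⟩≈b (≰⇒≥ yᵈ≰v)) refl ⟨
        (y ^ d · (y ^ d ⇒ v)) · u ≈⟨ assoc _ _ u ⟩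
        y ^ d · ((y ^ d ⇒ v) · u) ≈⟨ ·-cong refl (·-cong eq refl) ⟩
        y ^ d · ((y ^ (d ℕ.+ a) ⇒ y ^ suc (d ℕ.+ a)) · u)
                                  ≤⟨ ·-mono ≤-refl (step≤ b≤r) ⟩
        y ^ d · y                 ≈⟨ comm _ y ⟩
        y ^ suc d                 ∎
        where
        open ≤-Reasoning
        v = y ^ a ⇒ y ^ (a ℕ.+ suc d)
        b≡ : a ℕ.+ suc d ≡ suc (d ℕ.+ a)
        b≡ = ≡.trans (ℕ.+-suc a d) (≡.cong suc (ℕ.+-comm a d))
        b≤r : d ℕ.+ a ℕ.≤ r
        b≤r = ℕ.s≤s⁻¹ (≡.subst (ℕ._≤ R) b≡ a+1+d≤R)
        eq : y ^ d ⇒ v ≈ y ^ (d ℕ.+ a) ⇒ y ^ suc (d ℕ.+ a)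
        eq = trans (currying _ _ _) (⇒-cong (sym (^-+ y d a)) (^-≡ y b≡))

      ⇒-∸ : ∀ a b → b ℕ.≤ R → (y ^ a ⇒ y ^ b) · u ≤ y ^ (b ℕ.∸ a)
      ⇒-∸ a b b≤R with ℕ.≤-total a b
      ... | inj₁ a≤b = ≤-trans (·-monoˡ (⇒-monoʳ (≤-reflexive (^-≡ y (≡.sym a+[b∸a]≡b)))))
                         (⇒-^ a (b ℕ.∸ a) (≡.subst (ℕ._≤ R) (≡.sym a+[b∸a]≡b) b≤R))
        where a+[b∸a]≡b = ℕ.m+[n∸m]≡n a≤b
      ... | inj₂ b≤a = ≤-trans (≤⊤ _) (≤-reflexive (^-≡ y (≡.sym (ℕ.m≤n⇒m∸n≡0 b≤a))))

    -- Each node of the term may cost one factor `u`: a product spends it on `yʳ⁺¹·u≈⊥` when the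
    -- exponents exceed `R`, an implication on `⇒-∸`. The two bounds are mutual because implication
    -- is antitone in its premise.
    lower-bound : ∀ t → y ^ E t · u ^ size t ≤ termFunction A t y
    upper-bound : ∀ t → termFunction A t y · u ^ size t ≤ y ^ E t

    lower-bound (var _)  = ≤-trans (a·b≤a _ _) (≤-reflexive (^-1 y))
    lower-bound (s ·ₜ t) with ℕ.≤-total (E s ℕ.+ E t) R
    ... | inj₁ ≤R = begin
      y ^ (R ℕ.⊓ (E s ℕ.+ E t)) · u ^ size (s ·ₜ t)
        ≈⟨ ·-cong (trans (^-≡ y (ℕ.m≥n⇒m⊓n≡n ≤R)) (^-+ y (E s) (E t))) refl ⟩
      (y ^ E s · y ^ E t) · u ^ size (s ·ₜ t)
        ≤⟨ ^·^ (size s) (size t) (lower-bound s) (lower-bound t) ⟩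
      (termFunction A s y · termFunction A t y) · u
        ≤⟨ a·b≤a _ u ⟩
      termFunction A s y · termFunction A t y ∎
      where open ≤-Reasoning
    ... | inj₂ R≤ = begin
      y ^ (R ℕ.⊓ (E s ℕ.+ E t)) · u ^ size (s ·ₜ t)
        ≈⟨ ·-cong (^-≡ y (ℕ.m≤n⇒m⊓n≡m R≤)) refl ⟩
      y ^ R · (u · u ^ (size s ℕ.+ size t))
        ≤⟨ ·-mono ≤-refl (a·b≤a u _) ⟩
      y ^ R · u
        ≤⟨ yʳ⁺¹·u≈⊥ _ ⟩
      termFunction A s y · termFunction A t y ∎
      where open ≤-Reasoning
    lower-bound (s ⇒ₜ t) = residuate (begin
      (y ^ (E t ℕ.∸ E s) · u ^ size (s ⇒ₜ t)) · S
        ≈⟨ xy∙z≈xz∙y _ _ S ⟩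
      (y ^ (E t ℕ.∸ E s) · S) · (u · u ^ (size s ℕ.+ size t))
        ≤⟨ ·-mono ≤-refl (≤-trans (a·b≤b u _) (≤-reflexive (^-+ u (size s) (size t)))) ⟩
      (y ^ (E t ℕ.∸ E s) · S) · (u ^ size s · u ^ size t)
        ≈⟨ trans (assoc _ S _) (·-cong refl (sym (assoc S _ _))) ⟩
      y ^ (E t ℕ.∸ E s) · ((S · u ^ size s) · u ^ size t)
        ≤⟨ ·-mono ≤-refl (·-monoˡ (upper-bound s)) ⟩
      y ^ (E t ℕ.∸ E s) · (y ^ E s · u ^ size t)
        ≈⟨ trans (sym (assoc _ _ _)) (·-cong (sym (^-+ y (E t ℕ.∸ E s) (E s))) refl) ⟩
      y ^ ((E t ℕ.∸ E s) ℕ.+ E s) · u ^ size t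
        ≤⟨ ·-monoˡ (^-anti y (ℕ.≤-trans (ℕ.m≤n+m∸n (E t) (E s)) (ℕ.≤-reflexive (ℕ.+-comm (E s) _)))) ⟩
      y ^ E t · u ^ size t
        ≤⟨ lower-bound t ⟩
      termFunction A t y ∎)
      where
      open ≤-Reasoning
      S = termFunction A s y
    lower-bound ⊤ₜ       = ≤⊤ _

    upper-bound (var _)  = ≤-trans (a·b≤a _ _) (≤-reflexive (sym (^-1 y)))
    upper-bound (s ·ₜ t) = begin
      (termFunction A s y · termFunction A t y) · u ^ size (s ·ₜ t)
        ≤⟨ ^·^ (size s) (size t) (upper-bound s) (upper-bound t) ⟩
      (y ^ E s · y ^ E t) · u
        ≤⟨ a·b≤a _ u ⟩
      y ^ E s · y ^ E t
        ≈⟨ ^-+ y (E s) (E t) ⟨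
      y ^ (E s ℕ.+ E t)
        ≤⟨ ^-anti y (ℕ.m⊓n≤n R (E s ℕ.+ E t)) ⟩
      y ^ (R ℕ.⊓ (E s ℕ.+ E t)) ∎
      where open ≤-Reasoning
    upper-bound (s ⇒ₜ t) = begin
      (S ⇒ T) · (u · u ^ (size s ℕ.+ size t))
        ≈⟨ ·-cong refl (comm u _) ⟩
      (S ⇒ T) · (u ^ (size s ℕ.+ size t) · u)
        ≈⟨ assoc _ _ u ⟨
      ((S ⇒ T) · u ^ (size s ℕ.+ size t)) · u
        ≤⟨ ·-monoˡ (residuate implication) ⟩
      (y ^ E s ⇒ y ^ E t) · u
        ≤⟨ ⇒-∸ (E s) (E t) (evalŁ≤ r t) ⟩
      y ^ (E t ℕ.∸ E s) ∎
      where
      open ≤-Reasoning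
      S = termFunction A s y
      T = termFunction A t y
      implication : ((S ⇒ T) · u ^ (size s ℕ.+ size t)) · y ^ E s ≤ y ^ E t
      implication = begin
        ((S ⇒ T) · u ^ (size s ℕ.+ size t)) · y ^ E s
          ≈⟨ trans (assoc _ _ _) (·-cong refl (trans (·-cong (^-+ u (size s) (size t)) refl) (trans (comm _ _) (sym (assoc _ _ _))))) ⟩
        (S ⇒ T) · ((y ^ E s · u ^ size s) · u ^ size t)
          ≤⟨ ·-mono ≤-refl (·-monoˡ (lower-bound s)) ⟩
        (S ⇒ T) · (S · u ^ size t)
          ≈⟨ assoc _ _ _ ⟨
        ((S ⇒ T) · S) · u ^ size t
          ≤⟨ ·-monoˡ (⟨a⇒b⟩·a≤b S T) ⟩
        T · u ^ size t
          ≤⟨ upper-bound t ⟩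
        y ^ E t ∎
    upper-bound ⊤ₜ       = ≤⊤ _

    module _ {t : UnaryTerm} (separated : ¬ (y · u ^ size t ≤ y · y)) where

      -- `separated` says that the error `u ^ size t` does not bridge `y` and `y · y`. An exponent 0
      -- would put the error itself below `y`, and an exponent of at least 2 would put
      -- `y · u ^ size t` below `y · y`.
      fixed⇒evalŁ≡1 : y ≤ termFunction A t y → termFunction A t y ≤ y → E t ≡ 1
      fixed⇒evalŁ≡1 y≤ ≤y with E t | lower-bound t | upper-bound t
      ... | zero        | low | up = contradiction
        (·-mono ≤-refl (≤-trans (≤-reflexive (sym (identityˡ _))) (≤-trans low ≤y))) separated
      ... | suc zero    | low | up = ≡.refl
      ... | suc (suc n) | low | up = contradiction
        (≤-trans (·-monoˡ y≤) (≤-trans up (·-mono ≤-refl (a·b≤a y _)))) separated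

      min⇒evalŁ≢1 : IsMin (termFunction A t y) → ¬ E t ≡ 1
      min⇒evalŁ≢1 min E≡1 = separated (begin
        y · u ^ size t        ≈⟨ ·-cong (trans (^-≡ y E≡1) (^-1 y)) refl ⟨
        y ^ E t · u ^ size t  ≤⟨ lower-bound t ⟩
        termFunction A t y    ≤⟨ min _ ⟩
        y · y                 ∎)
        where open ≤-Reasoning

  ^-step : ∀ {y} r → ¬ IsMin (y ^ suc r) → y ^ r ⇒ y ^ suc r ≤ y
  ^-step {y} r yʳ⁺¹≉⊥ = ·-cancelˡ (yʳ⁺¹≉⊥ ∘ IsMin-down (≤-reflexive (sym meet)))
    (≤-reflexive (trans meet (comm y (y ^ r))))
    where
    meet : y ^ r · (y ^ r ⇒ y ^ suc r) ≈ y ^ suc r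
    meet = b≤a⇒a·⟨a⇒b⟩≈b (a·b≤b y (y ^ r))

  Nilpotent⇒⊤≰ : ∀ {x} → Nilpotent x → ¬ IsMin x → ¬ (⊤ ≤ x)
  Nilpotent⇒⊤≰ {x} (n , xⁿ≈⊥) x≉⊥ ⊤≤x =
    x≉⊥ (IsMin-down (≤-trans (≤⊤ x) (≤-trans (⊤-^ n) (^-monoˡ n ⊤≤x))) xⁿ≈⊥)

  -- Approximate copies of Chang's algebra inside a chain.

  -- Below, a ⇒ o is the negation of a, and w generates Chang's MV-algebra as far
  -- as terms of bounded size can see.
  module ChangEvaluation (w o : Carrier) (o≈⊥ : IsMin o) where

    ⟦_⟧ᶜ : Chang → Carrier
    ⟦ pos i ⟧ᶜ = w ^ i
    ⟦ neg i ⟧ᶜ = w ^ i ⇒ o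

    atom : Carrier
    atom = ⟦ neg 1 ⟧ᶜ

    private
      involutive : ∀ a → (a ⇒ o) ⇒ o ≈ a
      involutive a = b≤a⇒⟨a⇒b⟩⇒b≈a (o≈⊥ a)

    neg≤pos : ∀ i j → ¬ IsMin (w ^ (i ℕ.+ j)) → w ^ i ⇒ o ≤ w ^ j
    neg≤pos i j wⁱ⁺ʲ≉⊥ = ≰⇒≥ λ wʲ≤ → wⁱ⁺ʲ≉⊥ (IsMin-down
      (≤-trans (≤-reflexive (trans (^-+ w i j) (comm _ _))) (unresiduate wʲ≤)) o≈⊥)

    private
      ^-split : ∀ {i j} → i ℕ.≤ j → w ^ j ≈ w ^ i · w ^ (j ℕ.∸ i)
      ^-split {i} {j} i≤j = trans (^-≡ w (≡.sym (ℕ.m+[n∸m]≡n i≤j))) (^-+ w i (j ℕ.∸ i))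

      pos·neg : ∀ i j → ¬ IsMin (w ^ (i ℕ.+ j)) → w ^ i · (w ^ j ⇒ o) ≈ w ^ (j ℕ.∸ i) ⇒ o
      pos·neg i j wⁱ⁺ʲ≉⊥ with ℕ.≤-total i j
      ... | inj₁ i≤j = trans (·-cong refl eq) (b≤a⇒a·⟨a⇒b⟩≈b (neg≤pos (j ℕ.∸ i) i
          (^-≉⊥ (ℕ.≤-trans (ℕ.≤-reflexive (ℕ.m∸n+n≡m i≤j)) (ℕ.m≤n+m j i)) wⁱ⁺ʲ≉⊥)))
        where
        eq : w ^ j ⇒ o ≈ w ^ i ⇒ (w ^ (j ℕ.∸ i) ⇒ o)
        eq = trans (⇒-cong (^-split i≤j) refl) (sym (currying _ _ o))
      ... | inj₂ j≤i = ≤-antisym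
        (≤-trans (·-monoˡ (^-anti w j≤i)) (≤-trans (a·⟨a⇒b⟩≤b _ o) (o≈⊥ _)))
        (≤-trans (≤-reflexive (trans (⇒-cong (^-≡ w (ℕ.m≤n⇒m∸n≡0 j≤i)) refl) (⊤-identityˡ-⇒ o))) (o≈⊥ _))

      pos⇒pos : ∀ i j → ¬ IsMin (w ^ (i ℕ.+ j)) → w ^ i ⇒ w ^ j ≈ w ^ (j ℕ.∸ i)
      pos⇒pos i j wⁱ⁺ʲ≉⊥ with ℕ.≤-total i j
      ... | inj₁ i≤j = ≤-antisym
        (·-cancelˡ (^-≉⊥ (ℕ.m≤n+m j i) wⁱ⁺ʲ≉⊥ ∘ IsMin-down (≤-reflexive (sym meet)))
          (≤-reflexive (trans meet (^-split i≤j))))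
        (residuate (≤-reflexive (trans (comm _ _) (sym (^-split i≤j)))))
        where
        meet : w ^ i · (w ^ i ⇒ w ^ j) ≈ w ^ j
        meet = b≤a⇒a·⟨a⇒b⟩≈b (^-anti w i≤j)
      ... | inj₂ j≤i = trans (^-anti w j≤i) (sym (^-≡ w (ℕ.m≤n⇒m∸n≡0 j≤i)))

    ⟦·⟧ᶜ : ∀ a b → ¬ IsMin (w ^ (∣ a ∣ᶜ ℕ.+ ∣ b ∣ᶜ)) → ⟦ a ⟧ᶜ · ⟦ b ⟧ᶜ ≈ ⟦ a ·ᶜ b ⟧ᶜ
    ⟦·⟧ᶜ (pos i) (pos j) _    = sym (^-+ w i j)
    ⟦·⟧ᶜ (pos i) (neg j) wⁿ≉⊥ = pos·neg i j wⁿ≉⊥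
    ⟦·⟧ᶜ (neg i) (pos j) wⁿ≉⊥ = trans (comm _ _)
      (pos·neg j i (wⁿ≉⊥ ∘ IsMin-down (≤-reflexive (^-≡ w (ℕ.+-comm i j)))))
    ⟦·⟧ᶜ (neg i) (neg j) wⁿ≉⊥ = ≤-antisym
      (≤-trans (·-monoˡ (neg≤pos i j wⁿ≉⊥)) (≤-trans (a·⟨a⇒b⟩≤b _ o) (o≈⊥ _)))
      (≤-trans (≤-reflexive (⊤-identityˡ-⇒ o)) (o≈⊥ _))

    ⟦⇒⟧ᶜ : ∀ a b → ¬ IsMin (w ^ (∣ a ∣ᶜ ℕ.+ ∣ b ∣ᶜ)) → ⟦ a ⟧ᶜ ⇒ ⟦ b ⟧ᶜ ≈ ⟦ a ⇒ᶜ b ⟧ᶜ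
    ⟦⇒⟧ᶜ (pos i) (pos j) wⁿ≉⊥ = pos⇒pos i j wⁿ≉⊥
    ⟦⇒⟧ᶜ (pos i) (neg j) _    = trans (currying _ _ o) (⇒-cong (sym (^-+ w i j)) refl)
    ⟦⇒⟧ᶜ (neg i) (pos j) wⁿ≉⊥ = neg≤pos i j wⁿ≉⊥
    ⟦⇒⟧ᶜ (neg i) (neg j) wⁿ≉⊥ = begin-equality
      (w ^ i ⇒ o) ⇒ (w ^ j ⇒ o)   ≈⟨ currying _ _ o ⟩
      ((w ^ i ⇒ o) · w ^ j) ⇒ o   ≈⟨ ⇒-cong (comm _ _) refl ⟩
      (w ^ j · (w ^ i ⇒ o)) ⇒ o   ≈⟨ currying _ _ o ⟨
      w ^ j ⇒ ((w ^ i ⇒ o) ⇒ o)   ≈⟨ ⇒-cong refl (involutive (w ^ i)) ⟩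
      w ^ j ⇒ w ^ i               ≈⟨ pos⇒pos j i (wⁿ≉⊥ ∘ IsMin-down (≤-reflexive (^-≡ w (ℕ.+-comm i j)))) ⟩
      w ^ (i ℕ.∸ j)               ∎
      where open ≤-Reasoning

    termFunction≈ : ∀ t → ¬ IsMin (w ^ size t) → termFunction A t atom ≈ ⟦ evalC t ⟧ᶜ
    termFunction≈ (var _)  _    = refl
    termFunction≈ (s ·ₜ t) wⁿ≉⊥ = trans
      (·-cong (termFunction≈ s (^-≉⊥ (ℕ.m≤n⇒m≤1+n (ℕ.m≤m+n (size s) (size t))) wⁿ≉⊥))
              (termFunction≈ t (^-≉⊥ (ℕ.m≤n⇒m≤1+n (ℕ.m≤n+m (size t) (size s))) wⁿ≉⊥)))
      (⟦·⟧ᶜ (evalC s) (evalC t) (^-≉⊥ (ℕ.m≤n⇒m≤1+n (ℕ.+-mono-≤ (∣evalC∣≤size s) (∣evalC∣≤size t))) wⁿ≉⊥))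
    termFunction≈ (s ⇒ₜ t) wⁿ≉⊥ = trans
      (⇒-cong (termFunction≈ s (^-≉⊥ (ℕ.m≤n⇒m≤1+n (ℕ.m≤m+n (size s) (size t))) wⁿ≉⊥))
              (termFunction≈ t (^-≉⊥ (ℕ.m≤n⇒m≤1+n (ℕ.m≤n+m (size t) (size s))) wⁿ≉⊥)))
      (⟦⇒⟧ᶜ (evalC s) (evalC t) (^-≉⊥ (ℕ.m≤n⇒m≤1+n (ℕ.+-mono-≤ (∣evalC∣≤size s) (∣evalC∣≤size t))) wⁿ≉⊥))
    termFunction≈ ⊤ₜ       _    = refl

    module _ {t : UnaryTerm} (wⁿ≉⊥ : ¬ IsMin (w ^ suc (size t))) (atom≉⊥ : ¬ IsMin atom) where

      private
        value = termFunction≈ t (^-≉⊥ (ℕ.n≤1+n (size t)) wⁿ≉⊥)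

      -- Every other value is absurd. `pos j` below the atom makes `w ^ suc j` minimal, where
      -- `j ≤ size t`; hence the exponent `suc (size t)` in the hypothesis. `neg 0` makes the atom
      -- minimal. A larger `neg` gives `w ≤ w · w`, so `w` is ⊤ and its negation, the atom, is
      -- minimal.
      fixed⇒evalC≡neg1 : atom ≤ termFunction A t atom → termFunction A t atom ≤ atom →
                         evalC t ≡ neg 1
      fixed⇒evalC≡neg1 ≤t t≤ with evalC t | value | ∣evalC∣≤size t
      ... | pos j             | eq | j≤ = contradiction
        (IsMin-down (≤-trans (≤-reflexive (trans (comm w (w ^ j)) (·-cong refl (sym (^-1 w)))))
          (unresiduate (≤-trans (≤-reflexive (sym eq)) t≤))) o≈⊥)
        (^-≉⊥ (s≤s j≤) wⁿ≉⊥)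
      ... | neg zero          | eq | _  = contradiction
        (IsMin-down (≤-trans ≤t (≤-reflexive (trans eq (⊤-identityˡ-⇒ o)))) o≈⊥) atom≉⊥
      ... | neg (suc zero)    | eq | _  = ≡.refl
      ... | neg (suc (suc j)) | eq | _  = contradiction
        (IsMin-down (≤-trans (≤-reflexive (sym (identityʳ atom)))
          (≤-trans (·-mono ≤-refl (≤-trans ⊤≤w (≤-reflexive (sym (^-1 w))))) (⟨a⇒b⟩·a≤b (w ^ 1) o))) o≈⊥)
        atom≉⊥
        where
        w≤w²⁺ʲ : w ^ 1 ≤ w ^ suc (suc j)
        w≤w²⁺ʲ = begin
          w ^ 1                           ≈⟨ involutive (w ^ 1) ⟨
          (w ^ 1 ⇒ o) ⇒ o                 ≤⟨ ⇒-antiˡ (≤-trans (≤-reflexive (sym eq)) t≤) ⟩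
          (w ^ suc (suc j) ⇒ o) ⇒ o       ≈⟨ involutive _ ⟩
          w ^ suc (suc j)                 ∎
          where open ≤-Reasoning
        ⊤≤w : ⊤ ≤ w
        ⊤≤w = ≤·⇒⊤≤ (base-≉⊥ w (size t) wⁿ≉⊥) (begin
          w                 ≈⟨ ^-1 w ⟨
          w ^ 1             ≤⟨ w≤w²⁺ʲ ⟩
          w · (w · w ^ j)   ≤⟨ ·-mono ≤-refl (a·b≤a w _) ⟩
          w · w             ∎)
          where open ≤-Reasoning

      min⇒evalC≢neg1 : IsMin (termFunction A t atom) → ¬ evalC t ≡ neg 1
      min⇒evalC≢neg1 min eq = atom≉⊥ (IsMin-down
        (≤-reflexive (sym (trans value (≡.subst (λ a → ⟦ evalC t ⟧ᶜ ≈ ⟦ a ⟧ᶜ) eq refl)))) min)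

  -- Nilpotency indices, and the consequences of a large index.

  Bounded : ℕ → Set (c ⊔ ℓ)
  Bounded n = ∀ y → Nilpotent y → IsMin (y ^ n)

  unbounded-witness : ∀ {n} → ¬ Bounded n → ∃[ y ] Nilpotent y × ¬ IsMin (y ^ n)
  unbounded-witness {n} unbounded with em {P = ∃[ y ] Nilpotent y × ¬ IsMin (y ^ n)}
  ... | yes witness = witness
  ... | no  none    = contradiction bounded unbounded
    where
    bounded : Bounded n
    bounded y y-nilp with em {P = IsMin (y ^ n)}
    ... | yes min  = min
    ... | no  ¬min = contradiction (y , y-nilp , ¬min) none

  jump : ∀ {p} (P : ℕ → Set p) n → ¬ P 0 → P n → ∃[ m ] ¬ P m × P (suc m)
  jump P zero    ¬P0 Pn = contradiction Pn ¬P0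
  jump P (suc n) ¬P0 Pn with em {P = P n}
  ... | yes Pn′ = jump P n ¬P0 Pn′
  ... | no  ¬Pn = n , ¬Pn , Pn

  module _ (t : UnaryTerm) (t-conucleus : IsMultiplicativeConucleus A (termFunction A t))
           {x : Carrier} (x-nilp : Nilpotent x) where

    open IsMultiplicativeConucleus t-conucleus using (contractive)
    open Conucleus t t-conucleus

    -- Here `x` itself plays the co-atom. Its power `x ^ size t` is not minimal, so `t` fixes `x`,
    -- hence everything, the atom included.
    unbounded⇒evalC≡neg1 : ¬ IsMin (x ^ suc (size t)) → evalC t ≡ neg 1
    unbounded⇒evalC≡neg1 xⁿ≉⊥ = fixed⇒evalC≡neg1 {t} xⁿ≉⊥ atom≉⊥ (fixed atom) (contractive atom)
      where
      open ChangEvaluation x (x ^ proj₁ x-nilp) (proj₂ x-nilp)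
      x≉⊥ : ¬ IsMin x
      x≉⊥ = base-≉⊥ x (size t) xⁿ≉⊥
      fixed : ∀ y → y ≤ termFunction A t y
      fixed = fixes-all x-nilp x≉⊥ (^size≉⊥⇒fixed (^-≉⊥ (ℕ.n≤1+n (size t)) xⁿ≉⊥))
      atom≉⊥ : ¬ IsMin atom
      atom≉⊥ min = Nilpotent⇒⊤≰ x-nilp x≉⊥ (begin
        ⊤                             ≤⟨ ≤⇒⊤≤ (min _) ⟩
        atom ⇒ x ^ proj₁ x-nilp       ≈⟨ b≤a⇒⟨a⇒b⟩⇒b≈a (proj₂ x-nilp _) ⟩
        x ^ 1                         ≈⟨ ^-1 x ⟩
        x                             ∎)
        where open ≤-Reasoning

    -- The co-atom is approximated by `y = x ^ i` with error `u = x ^ r`, where `u ^ i`, which is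
    -- `y ^ r`, is not minimal but the next power of `u` is.
    unbounded⇒evalŁ≡1 : ∀ m → ¬ IsMin (x ^ (suc ((2 ℕ.+ m) ℕ.* size t) ℕ.* (2 ℕ.+ m))) →
                        evalŁ (2 ℕ.+ m) t ≡ 1
    unbounded⇒evalŁ≡1 m xᴺ≉⊥ = fixed⇒evalŁ≡1 {t} separated (fixed y) (contractive y)
      where
      r = 2 ℕ.+ m
      k = size t
      -- The shift by `suc (r * k)` makes `i` exceed `r * k`, so that the accumulated error `u ^ k`
      -- stays above `y` with a factor `x` to spare.
      P : ℕ → Set (c ⊔ ℓ)
      P j = IsMin ((x ^ r) ^ (j ℕ.+ suc (r ℕ.* k)))
      n = proj₁ x-nilp
      Pn : P n
      Pn = IsMin-down (≤-trans (≤-reflexive (^-* x (n ℕ.+ suc (r ℕ.* k)) r))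
        (^-anti x (ℕ.≤-trans (ℕ.m≤m+n n (suc (r ℕ.* k))) (ℕ.m≤m*n (n ℕ.+ suc (r ℕ.* k)) r)))) (proj₂ x-nilp)
      gap : ∃[ j ] ¬ P j × P (suc j)
      gap = jump P n (xᴺ≉⊥ ∘ IsMin-down (≤-reflexive (sym (^-* x (suc (r ℕ.* k)) r)))) Pn
      i = proj₁ gap ℕ.+ suc (r ℕ.* k)
      y = x ^ i
      u = x ^ r
      yʳ≈uⁱ : y ^ r ≈ u ^ i
      yʳ≈uⁱ = trans (^-* x r i) (trans (^-≡ x (ℕ.*-comm r i)) (sym (^-* x i r)))
      yʳ≉⊥ : ¬ IsMin (y ^ r)
      yʳ≉⊥ = proj₁ (proj₂ gap) ∘ IsMin-down (≤-reflexive (sym yʳ≈uⁱ))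
      yʳ·u≈⊥ : IsMin (y ^ r · u)
      yʳ·u≈⊥ = IsMin-down (≤-reflexive (trans (·-cong yʳ≈uⁱ refl) (comm _ u))) (proj₂ (proj₂ gap))
      open Approximation y u (suc m) (^-≉⊥ (ℕ.n≤1+n (suc m)) yʳ≉⊥) yʳ·u≈⊥
        (≤-trans (a·b≤a _ u) (^-step (suc m) yʳ≉⊥))
      y≉⊥ : ¬ IsMin y
      y≉⊥ = base-≉⊥ y (suc m) yʳ≉⊥
      xʳᵏ≉⊥ : ¬ IsMin (x ^ (r ℕ.* k))
      xʳᵏ≉⊥ = ^-≉⊥ (ℕ.≤-trans (ℕ.n≤1+n _) (ℕ.m≤n+m _ (proj₁ gap))) y≉⊥
      x≉⊥ : ¬ IsMin x
      x≉⊥ min = y≉⊥ (IsMin-down (≤-trans (^-anti x {1} (ℕ.≤-trans (s≤s z≤n) (ℕ.m≤n+m _ (proj₁ gap)))) (≤-reflexive (^-1 x))) min)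
      ⊤≰x : ¬ (⊤ ≤ x)
      ⊤≰x = Nilpotent⇒⊤≰ x-nilp x≉⊥
      uᵏ≈ : u ^ k ≈ x ^ (r ℕ.* k)
      uᵏ≈ = trans (^-* x k r) (^-≡ x (ℕ.*-comm k r))
      y≤uᵏ·x : y ≤ x ^ (r ℕ.* k) · x
      y≤uᵏ·x = ≤-trans (^-anti x (ℕ.m≤n+m _ (proj₁ gap))) (≤-reflexive (comm x _))
      y·y≉⊥ : ¬ IsMin (y · y)
      y·y≉⊥ = square-≉⊥ y m yʳ≉⊥
      separated : ¬ (y · u ^ k ≤ y · y)
      -- Cancelling `y` gives `u ^ k ≤ y ≤ u ^ k · x`, which would make `x` equal to ⊤.
      separated y·uᵏ≤y·y = ⊤≰x (≤·⇒⊤≤ xʳᵏ≉⊥ (≤-trans (≤-trans (≤-reflexive (sym uᵏ≈))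
          (·-cancelˡ (y·y≉⊥ ∘ IsMin-down (·-mono ≤-refl y≤uᵏ)) y·uᵏ≤y·y)) y≤uᵏ·x))
        where
        y≤uᵏ : y ≤ u ^ k
        y≤uᵏ = ≤-trans y≤uᵏ·x (≤-trans (a·b≤a _ x) (≤-reflexive (sym uᵏ≈)))
      fixed : ∀ z → z ≤ termFunction A t z
      fixed = fixes-all x-nilp x≉⊥ (^size≉⊥⇒fixed
        (^-≉⊥ (ℕ.≤-trans (ℕ.m≤n*m k r) (ℕ.≤-trans (ℕ.n≤1+n _) (ℕ.m≤n+m _ (proj₁ gap)))) y≉⊥))

  -- Two conuclei that disagree on a chain.

  module _ (t s : UnaryTerm)
    (t-conucleus : IsMultiplicativeConucleus A (termFunction A t))
    (s-conucleus : IsMultiplicativeConucleus A (termFunction A s))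
    (agreeC : evalC t ≡ neg 1 → evalC s ≡ neg 1)
    -- Agreement is asked only where `Bounded (suc m)` fails, so that a bound on the indices leaves
    -- finitely many conditions.
    (agreeŁ : ∀ m → ¬ Bounded (suc m) → evalŁ (2 ℕ.+ m) t ≡ 1 → evalŁ (2 ℕ.+ m) s ≡ 1)
    where

    private
      module T = Conucleus t t-conucleus
      module S = Conucleus s s-conucleus
      contractive = IsMultiplicativeConucleus.contractive t-conucleus

    module _ {x : Carrier} (x≉⊥ : ¬ IsMin x) (x≤tx : x ≤ termFunction A t x)
             (sx≈⊥ : IsMin (termFunction A s x)) where

      private
        x-nilp : Nilpotent x
        x-nilp = size s , IsMin-down (x^size≤ s x) sx≈⊥

        t-fixes : ∀ y → y ≤ termFunction A t y
        t-fixes = T.fixes-all x-nilp x≉⊥ x≤tx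

        s-kills : ∀ {y} → Nilpotent y → ¬ IsMin y → IsMin (termFunction A s y)
        s-kills {y} y-nilp y≉⊥ with em {P = IsMin (termFunction A s y)}
        ... | yes min  = min
        ... | no  ¬min = contradiction
          (IsMin-down (S.fixes-all y-nilp y≉⊥ (S.≉⊥⇒fixed ¬min) x) sx≈⊥) x≉⊥

        -- `s` kills every non-minimal nilpotent element, and its values lie above `size s`-th
        -- powers. The successor suits the search in `gap`, which starts at exponent 1, where `x`
        -- itself refutes the bound.
        bounded : Bounded (suc (size s))
        bounded y y-nilp with em {P = IsMin y}
        ... | yes min  = IsMin-down (a·b≤a y _) min
        ... | no  ¬min = IsMin-down (≤-trans (a·b≤b y _) (x^size≤ s y)) (s-kills y-nilp ¬min)

        gap : ∃[ m ] ¬ Bounded (suc m) × Bounded (2 ℕ.+ m)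
        gap = jump (Bounded ∘ suc) (size s)
          (λ bounded₁ → x≉⊥ (IsMin-down (≤-reflexive (sym (^-1 x))) (bounded₁ x x-nilp))) bounded

      module _ (m : ℕ) (unbounded : ¬ Bounded (suc m)) (bounded′ : Bounded (2 ℕ.+ m))
               {y : Carrier} (y-nilp : Nilpotent y) (yᵐ⁺¹≉⊥ : ¬ IsMin (y ^ suc m)) where

        private
          y≉⊥ : ¬ IsMin y
          y≉⊥ = base-≉⊥ y m yᵐ⁺¹≉⊥

          ⊤≰y : ¬ (⊤ ≤ y)
          ⊤≰y = Nilpotent⇒⊤≰ y-nilp y≉⊥

          w : Carrier
          w = y ^ suc m ⇒ y ^ (2 ℕ.+ m)

          y²⁺ᵐ≈⊥ : IsMin (y ^ (2 ℕ.+ m))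
          y²⁺ᵐ≈⊥ = bounded′ y y-nilp

        -- Here `w` is the negation of `y ^ suc m`. If it is nilpotent, `w ^ (2 + m)` is minimal, so
        -- `w ^ suc m` is below the negation of `w`, that is, below `y ^ suc m`. This forces
        -- `w ≤ y`, so `y` generates an exact Łukasiewicz chain and the error can be taken to be ⊤.
        discrete-impossible : ¬ Nilpotent w
        discrete-impossible w-nilp = min⇒evalŁ≢1 {s} (separated (size s)) (s-kills y-nilp y≉⊥)
          (agreeŁ m unbounded (fixed⇒evalŁ≡1 {t} (separated (size t)) (t-fixes y) (contractive y)))
          where
          wᵐ⁺¹≤yᵐ⁺¹ : w ^ suc m ≤ y ^ suc m
          wᵐ⁺¹≤yᵐ⁺¹ = ≤-trans
            (residuate (≤-trans (≤-reflexive (comm _ w)) (bounded′ w w-nilp _)))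
            (≤-reflexive (b≤a⇒⟨a⇒b⟩⇒b≈a (y²⁺ᵐ≈⊥ _)))
          w≤y : w ≤ y
          w≤y with total w y
          ... | inj₁ w≤y = w≤y
          ... | inj₂ y≤w = ⊤≤⇒≤ (≤·⇒⊤≤ (yᵐ⁺¹≉⊥ ∘ IsMin-down (^-monoˡ (suc m) y≤w)) (begin
            w ^ suc m               ≤⟨ wᵐ⁺¹≤yᵐ⁺¹ ⟩
            y · y ^ m               ≤⟨ ·-mono (≤-reflexive (sym (b≤a⇒a·⟨a⇒b⟩≈b y≤w))) (^-monoˡ m y≤w) ⟩
            (w · (w ⇒ y)) · w ^ m   ≈⟨ xy∙z≈xz∙y w _ _ ⟩
            w ^ suc m · (w ⇒ y)     ∎))
            where open ≤-Reasoning
          open Approximation y ⊤ (suc m) yᵐ⁺¹≉⊥ (IsMin-down (a·b≤a _ ⊤) y²⁺ᵐ≈⊥)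
            (≤-trans (a·b≤a w ⊤) w≤y)
          separated : ∀ k → ¬ (y · ⊤ ^ k ≤ y · y)
          separated k y·⊤≤y·y = ⊤≰y (≤·⇒⊤≤ y≉⊥ (≤-trans (≤-reflexive (sym (identityʳ y)))
            (≤-trans (·-mono ≤-refl (⊤-^ k)) y·⊤≤y·y)))

      module _ {y : Carrier} (y-nilp : Nilpotent y) where

        -- If the negation `w` of `y` is not nilpotent, then no power of it is minimal and it can
        -- play Chang's co-atom for terms of any size. The atom is fixed by `t` and killed by `s`,
        -- against `agreeC`.
        chang-impossible : Bounded 2 → ¬ IsMin (y ^ 1) → Nilpotent (y ^ 1 ⇒ y ^ 2)
        chang-impossible bounded₂ y≉⊥ with em {P = Nilpotent (y ^ 1 ⇒ y ^ 2)}
        ... | yes w-nilp  = w-nilp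
        ... | no  ¬w-nilp = contradiction
          (agreeC (fixed⇒evalC≡neg1 {t} (wⁿ≉⊥ (suc (size t))) atom≉⊥ (t-fixes atom) (contractive atom)))
          (min⇒evalC≢neg1 {s} (wⁿ≉⊥ (suc (size s))) atom≉⊥ (s-kills atom-nilp atom≉⊥))
          where
          w = y ^ 1 ⇒ y ^ 2
          wⁿ≉⊥ : ∀ n → ¬ IsMin (w ^ n)
          wⁿ≉⊥ n min = ¬w-nilp (n , min)
          open ChangEvaluation w (y ^ 2) (bounded₂ y y-nilp)
          atom-nilp : Nilpotent atom
          atom-nilp = 2 , IsMin-down (begin
            atom · atom ^ 1   ≤⟨ ·-mono ≤-refl (≤-trans (≤-reflexive (^-1 atom)) (neg≤pos 1 1 (wⁿ≉⊥ 2))) ⟩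
            atom · w ^ 1      ≤⟨ ⟨a⇒b⟩·a≤b (w ^ 1) (y ^ 2) ⟩
            y ^ 2             ∎) (bounded₂ y y-nilp)
            where open ≤-Reasoning
          atom≉⊥ : ¬ IsMin atom
          atom≉⊥ min = Nilpotent⇒⊤≰ y-nilp (y≉⊥ ∘ IsMin-down (≤-reflexive (^-1 y)))
            (≤·⇒⊤≤ y≉⊥ (≤-trans (⊤≤⇒≤ (begin
              ⊤                 ≤⟨ ≤⇒⊤≤ (min _) ⟩
              atom ⇒ y ^ 2      ≈⟨ b≤a⇒⟨a⇒b⟩⇒b≈a (bounded₂ y y-nilp _) ⟩
              w ^ 1             ≈⟨ ^-1 w ⟩
              y ^ 1 ⇒ y ^ 2     ∎)) (≤-reflexive (comm y (y ^ 1)))))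
            where open ≤-Reasoning

        -- If `w` is not nilpotent, no power of it is below the nilpotent `y`, so `w` can serve as
        -- the error. Since `y ^ (2 + m) · w` is minimal, `y ^ (2 + m)` counts as the bottom, and
        -- the chain is one element shorter than in the discrete case.
        infinitesimal-impossible : ∀ m → ¬ Bounded (2 ℕ.+ m) → Bounded (3 ℕ.+ m) →
          ¬ IsMin (y ^ (2 ℕ.+ m)) → Nilpotent (y ^ (2 ℕ.+ m) ⇒ y ^ (3 ℕ.+ m))
        infinitesimal-impossible m unbounded bounded′ yʳ≉⊥
          with em {P = Nilpotent (y ^ (2 ℕ.+ m) ⇒ y ^ (3 ℕ.+ m))}
        ... | yes w-nilp  = w-nilp
        ... | no  ¬w-nilp = contradiction
          (agreeŁ m (unbounded ∘ Bounded-suc) (fixed⇒evalŁ≡1 {t} (separated (size t)) (t-fixes y) (contractive y)))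
          (min⇒evalŁ≢1 {s} (separated (size s)) (s-kills y-nilp y≉⊥))
          where
          w = y ^ (2 ℕ.+ m) ⇒ y ^ (3 ℕ.+ m)
          Bounded-suc : Bounded (suc m) → Bounded (2 ℕ.+ m)
          Bounded-suc b z z-nilp = IsMin-down (a·b≤b z _) (b z z-nilp)
          y≉⊥ : ¬ IsMin y
          y≉⊥ = base-≉⊥ y (suc m) yʳ≉⊥
          open Approximation y w (suc m) (^-≉⊥ (ℕ.n≤1+n (suc m)) yʳ≉⊥)
            (IsMin-down (a·⟨a⇒b⟩≤b _ _) (bounded′ y y-nilp))
            (≤-trans (a·b≤a _ w) (^-step (suc m) yʳ≉⊥))
          y·y≉⊥ : ¬ IsMin (y · y)
          y·y≉⊥ = square-≉⊥ y m yʳ≉⊥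
          wᵏ≰y : ∀ k → ¬ (w ^ k ≤ y)
          wᵏ≰y k wᵏ≤y = ¬w-nilp (Nilpotent-^ k (Nilpotent-down wᵏ≤y y-nilp))
          separated : ∀ k → ¬ (y · w ^ k ≤ y · y)
          separated k y·wᵏ≤y·y = wᵏ≰y k
            (·-cancelˡ (y·y≉⊥ ∘ IsMin-down (·-mono ≤-refl (≰⇒≥ (wᵏ≰y k)))) y·wᵏ≤y·y)

      -- If y ^ n is non-minimal for the largest n for which some nilpotent
      -- element allows this, then y generates a Łukasiewicz chain with n + 2
      -- elements, or one with n + 1 elements modulo infinitesimals, according to
      -- whether y ^ n ⇒ ⊥ is nilpotent; in the second case n = 1 is Chang's algebra.
      disagreement-impossible : ⊥
      disagreement-impossible with gap
      ... | m , unbounded , bounded′ with unbounded-witness {suc m} unbounded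
      disagreement-impossible | zero , unbounded , bounded′ | y , y-nilp , y≉⊥ =
        discrete-impossible zero unbounded bounded′ {y} y-nilp y≉⊥
          (chang-impossible {y} y-nilp bounded′ y≉⊥)
      disagreement-impossible | suc m , unbounded , bounded′ | y , y-nilp , yʳ≉⊥ =
        discrete-impossible (suc m) unbounded bounded′ {y} y-nilp yʳ≉⊥
          (infinitesimal-impossible {y} y-nilp m unbounded bounded′ yʳ≉⊥)

  agree⇒≈ : ∀ t s →
    IsMultiplicativeConucleus A (termFunction A t) → IsMultiplicativeConucleus A (termFunction A s) →
    (evalC t ≡ neg 1 → evalC s ≡ neg 1) → (evalC s ≡ neg 1 → evalC t ≡ neg 1) →
    (∀ m → ¬ Bounded (suc m) → evalŁ (2 ℕ.+ m) t ≡ 1 → evalŁ (2 ℕ.+ m) s ≡ 1) →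
    (∀ m → ¬ Bounded (suc m) → evalŁ (2 ℕ.+ m) s ≡ 1 → evalŁ (2 ℕ.+ m) t ≡ 1) →
    ∀ x → termFunction A t x ≈ termFunction A s x
  agree⇒≈ t s ct cs t⇒sC s⇒tC t⇒sŁ s⇒tŁ x
    with em {P = IsMin (termFunction A t x)} | em {P = IsMin (termFunction A s x)}
  ... | yes tx≈⊥ | yes sx≈⊥ = ≤-antisym (tx≈⊥ _) (sx≈⊥ _)
  ... | no  tx≉⊥ | no  sx≉⊥ = ≤-antisym
    (≤-trans (IsMultiplicativeConucleus.contractive ct x) (Conucleus.≉⊥⇒fixed s cs sx≉⊥))
    (≤-trans (IsMultiplicativeConucleus.contractive cs x) (Conucleus.≉⊥⇒fixed t ct tx≉⊥))
  ... | no  tx≉⊥ | yes sx≈⊥ = contradiction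
    (disagreement-impossible t s ct cs t⇒sC t⇒sŁ
      (tx≉⊥ ∘ IsMin-down (IsMultiplicativeConucleus.contractive ct x)) (Conucleus.≉⊥⇒fixed t ct tx≉⊥) sx≈⊥) id
  ... | yes tx≈⊥ | no  sx≉⊥ = contradiction
    (disagreement-impossible s t cs ct s⇒tC s⇒tŁ
      (sx≉⊥ ∘ IsMin-down (IsMultiplicativeConucleus.contractive cs x)) (Conucleus.≉⊥⇒fixed s cs sx≉⊥) tx≈⊥) id

-- Filters and quotients.

-- Membership lives in `ℓ` so that quotients stay at the levels of `V`. Stating `∋-⊤` for all
-- elements above ⊤ makes membership upward closed and compatible with `≈`.
record Filter {c ℓ : Level} (A : Algebra c ℓ) : Set (c ⊔ lsuc ℓ) where
  open Algebra A
  field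
    _∋_          : Pred Carrier ℓ
    ∋-⊤          : ∀ {a} → ⊤ ≤ a → _∋_ a
    modus-ponens : ∀ {a b} → _∋_ (a ⇒ b) → _∋_ a → _∋_ b

open Filter using (_∋_; ∋-⊤; modus-ponens)

module HoopFilters {c ℓ : Level} (A : Algebra c ℓ) (isHoop : IsHoop A) where

  open Algebra A
  open HoopProperties A isHoop

  infix 4 _⊑_
  _⊑_ : Filter A → Filter A → Set (c ⊔ ℓ)
  F ⊑ G = ∀ {a} → F ∋ a → G ∋ a

  ∋-up : ∀ (F : Filter A) {a b} → a ≤ b → F ∋ a → F ∋ b
  ∋-up F a≤b = modus-ponens F (∋-⊤ F (≤⇒⊤≤ a≤b))

  ∋-· : ∀ (F : Filter A) {a b} → F ∋ a → F ∋ b → F ∋ (a · b)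
  ∋-· F {a} {b} a∈F b∈F = modus-ponens F (∋-up F (residuate ≤-refl) a∈F) b∈F

  trivial : Filter A
  trivial = record
    { _∋_          = ⊤ ≤_
    ; ∋-⊤          = id
    ; modus-ponens = λ ⊤≤a⇒b ⊤≤a → ≤-trans ⊤≤a (⊤≤⇒≤ ⊤≤a⇒b)
    }

  extend : Filter A → Carrier → Filter A
  extend F p = record
    { _∋_          = λ a → ∃[ n ] F ∋ (p ^ n ⇒ a)
    ; ∋-⊤          = λ ⊤≤a → 0 , ∋-⊤ F (≤⇒⊤≤ ⊤≤a)
    ; modus-ponens = λ {a} {b} (m , f) (n , g) → m ℕ.+ n , ∋-up F (detach m n) (∋-· F f g)
    }
    where
    detach : ∀ m n {a b} → (p ^ m ⇒ (a ⇒ b)) · (p ^ n ⇒ a) ≤ p ^ (m ℕ.+ n) ⇒ b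
    detach m n {a} {b} = residuate (begin
      ((p ^ m ⇒ (a ⇒ b)) · (p ^ n ⇒ a)) · p ^ (m ℕ.+ n)       ≈⟨ ·-cong refl (^-+ p m n) ⟩
      ((p ^ m ⇒ (a ⇒ b)) · (p ^ n ⇒ a)) · (p ^ m · p ^ n)     ≈⟨ interchange _ _ _ _ ⟩
      ((p ^ m ⇒ (a ⇒ b)) · p ^ m) · ((p ^ n ⇒ a) · p ^ n)     ≤⟨ ·-mono (⟨a⇒b⟩·a≤b _ _) (⟨a⇒b⟩·a≤b _ _) ⟩
      (a ⇒ b) · a                                             ≤⟨ ⟨a⇒b⟩·a≤b a b ⟩
      b                                                       ∎)
      where open ≤-Reasoning

  ⊑-extend : ∀ (F : Filter A) p → F ⊑ extend F p
  ⊑-extend F p a∈F = 0 , ∋-up F b≤a⇒b a∈F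

  extend∋ : ∀ (F : Filter A) p → extend F p ∋ p
  extend∋ F p = 1 , ∋-⊤ F (≤⇒⊤≤ (≤-reflexive (^-1 p)))

  quotient : Filter A → Algebra c ℓ
  quotient F = record
    { Carrier       = Carrier
    ; _≈_           = λ a b → F ∋ (a ⇒ b) × F ∋ (b ⇒ a)
    ; _·_           = _·_
    ; _⇒_           = _⇒_
    ; ⊤             = ⊤
    ; isEquivalence = record
      { refl  = ∋-⊤ F (≤⇒⊤≤ ≤-refl) , ∋-⊤ F (≤⇒⊤≤ ≤-refl)
      ; sym   = λ (p , q) → q , p
      ; trans = λ (p , q) (p′ , q′) → ∋-up F ⇒-trans (∋-· F p p′) , ∋-up F ⇒-trans (∋-· F q′ q)
      }
    ; ·-cong        = λ (p , q) (p′ , q′) → ∋-up F ⇒-· (∋-· F p p′) , ∋-up F ⇒-· (∋-· F q q′)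
    ; ⇒-cong        = λ (p , q) (p′ , q′) → ∋-up F ⇒-⇒ (∋-· F q p′) , ∋-up F ⇒-⇒ (∋-· F p q′)
    }
    where
    ⇒-trans : ∀ {a b d} → (a ⇒ b) · (b ⇒ d) ≤ a ⇒ d
    ⇒-trans {a} {b} {d} = residuate (begin
      ((a ⇒ b) · (b ⇒ d)) · a   ≈⟨ xy∙z≈xz∙y _ _ a ⟩
      ((a ⇒ b) · a) · (b ⇒ d)   ≤⟨ ·-monoˡ (⟨a⇒b⟩·a≤b a b) ⟩
      b · (b ⇒ d)               ≤⟨ a·⟨a⇒b⟩≤b b d ⟩
      d                         ∎)
      where open ≤-Reasoning
    ⇒-· : ∀ {a b a′ b′} → (a ⇒ b) · (a′ ⇒ b′) ≤ (a · a′) ⇒ (b · b′)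
    ⇒-· = residuate (≤-trans (≤-reflexive (interchange _ _ _ _))
      (·-mono (⟨a⇒b⟩·a≤b _ _) (⟨a⇒b⟩·a≤b _ _)))
    ⇒-⇒ : ∀ {a b a′ b′} → (b ⇒ a) · (a′ ⇒ b′) ≤ (a ⇒ a′) ⇒ (b ⇒ b′)
    ⇒-⇒ {a} {b} {a′} {b′} = residuate (residuate (begin
      (((b ⇒ a) · (a′ ⇒ b′)) · (a ⇒ a′)) · b   ≈⟨ assoc _ _ b ⟩
      ((b ⇒ a) · (a′ ⇒ b′)) · ((a ⇒ a′) · b)   ≈⟨ ·-cong refl (comm _ b) ⟩
      ((b ⇒ a) · (a′ ⇒ b′)) · (b · (a ⇒ a′))   ≈⟨ interchange _ _ b _ ⟩
      ((b ⇒ a) · b) · ((a′ ⇒ b′) · (a ⇒ a′))   ≤⟨ ·-monoˡ (⟨a⇒b⟩·a≤b b a) ⟩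
      a · ((a′ ⇒ b′) · (a ⇒ a′))               ≈⟨ ·-cong refl (comm _ _) ⟩
      a · ((a ⇒ a′) · (a′ ⇒ b′))               ≈⟨ assoc a _ _ ⟨
      (a · (a ⇒ a′)) · (a′ ⇒ b′)               ≤⟨ ·-monoˡ (a·⟨a⇒b⟩≤b a a′) ⟩
      a′ · (a′ ⇒ b′)                           ≤⟨ a·⟨a⇒b⟩≤b a′ b′ ⟩
      b′                                       ∎))
      where open ≤-Reasoning

  quotient-total : ∀ (F : Filter A) → (∀ a b → F ∋ (a ⇒ b) ⊎ F ∋ (b ⇒ a)) → Total (quotient F)
  quotient-total F prime a b = Sum.map ∋⇒≈⊤ ∋⇒≈⊤ (prime a b)
    where
    ∋⇒≈⊤ : ∀ {d} → F ∋ d → F ∋ (d ⇒ ⊤) × F ∋ (⊤ ⇒ d)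
    ∋⇒≈⊤ d∈F = ∋-⊤ F (≤⇒⊤≤ (≤⊤ _)) , ∋-up F b≤a⇒b d∈F

  ⟦⟧-quotient : ∀ (F : Filter A) {x} {X : Set x} (t : Term X) ρ → Algebra.⟦_⟧ (quotient F) t ρ ≡ ⟦ t ⟧ ρ
  ⟦⟧-quotient F (var i)  ρ = ≡.refl
  ⟦⟧-quotient F (s ·ₜ t) ρ = ≡.cong₂ _·_ (⟦⟧-quotient F s ρ) (⟦⟧-quotient F t ρ)
  ⟦⟧-quotient F (s ⇒ₜ t) ρ = ≡.cong₂ _⇒_ (⟦⟧-quotient F s ρ) (⟦⟧-quotient F t ρ)
  ⟦⟧-quotient F ⊤ₜ       ρ = ≡.refl

  quotient-Mod : ∀ (F : Filter A) {e} (E : Rel (Term ℕ) e) → Mod E A → Mod E (quotient F)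
  quotient-Mod F E A⊨E s t sEt ρ
    rewrite ⟦⟧-quotient F s ρ | ⟦⟧-quotient F t ρ =
    ∋-⊤ F (≤⇒⊤≤ (≤-reflexive (A⊨E s t sEt ρ))) , ∋-⊤ F (≤⇒⊤≤ (≤-reflexive (sym (A⊨E s t sEt ρ))))

-- Prime filters from an enumeration of the elements.

module PrimeFilter (em : ∀ {a : Level} → ExcludedMiddle a) {c ℓ : Level} (A : Algebra c ℓ)
                   (isWajsbergHoop : IsWajsbergHoop A) where

  open Algebra A
  open WajsbergHoopProperties A isWajsbergHoop
  open HoopFilters A (IsWajsbergHoop.isHoop isWajsbergHoop)

  -- The product of the two members of `F` implies `d`: that implication lies above both powers,
  -- hence is ⊤ by `prelinearity-^`.
  extend-prelinear : ∀ (F : Filter A) a b {d} → extend F (a ⇒ b) ∋ d → extend F (b ⇒ a) ∋ d → F ∋ d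
  extend-prelinear F a b {d} (m , f) (n , g) = modus-ponens F
    (∋-⊤ F (prelinearity-^ a b m n (below (a·b≤a _ _)) (below (a·b≤b _ _))))
    (∋-· F f g)
    where
    below : ∀ {p q} → q ≤ p ⇒ d → p ≤ q ⇒ d
    below q≤p⇒d = residuate (≤-trans (≤-reflexive (comm _ _)) (unresiduate q≤p⇒d))

  module _ {d : Carrier} (⊤≰d : ¬ (⊤ ≤ d))
           (enum : ℕ → List Carrier) (enum-complete : ∀ a → ∃[ n ] a ∈ enum n) where

    private
      Avoiding : Set (c ⊔ lsuc ℓ)
      Avoiding = Σ[ F ∈ Filter A ] ¬ (F ∋ d)

      Decides : Filter A → Carrier → Set ℓ
      Decides F p = F ∋ p ⊎ extend F p ∋ d

      Decides-mono : ∀ (F G : Filter A) {p} → F ⊑ G → Decides F p → Decides G p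
      Decides-mono F G F⊑G = Sum.map F⊑G (λ (n , f) → n , F⊑G f)

      decide : (F : Avoiding) (p : Carrier) →
               Σ[ G ∈ Avoiding ] (proj₁ F ⊑ proj₁ G) × Decides (proj₁ G) p
      decide (F , d∉F) p with em {P = extend F p ∋ d}
      ... | yes d∈F+p = (F , d∉F) , id , inj₂ d∈F+p
      ... | no  d∉F+p = (extend F p , d∉F+p) , ⊑-extend F p , inj₁ (extend∋ F p)

      decideAll : (F : Avoiding) (ps : List Carrier) →
                  Σ[ G ∈ Avoiding ] (proj₁ F ⊑ proj₁ G) × (∀ {p} → p ∈ ps → Decides (proj₁ G) p)
      decideAll F []       = F , id , λ ()
      decideAll F (p ∷ ps) with decide F p
      ... | G , F⊑G , G-p with decideAll G ps
      ... | H , G⊑H , H-ps = H , G⊑H ∘ F⊑G , λ where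
        (here ≡.refl) → Decides-mono (proj₁ G) (proj₁ H) G⊑H G-p
        (there p∈ps)  → H-ps p∈ps

      stage : ℕ → Avoiding
      stage zero    = trivial , ⊤≰d
      stage (suc n) = proj₁ (decideAll (stage n) (enum n))

      stage-mono : ∀ {m n} → m ℕ.≤′ n → proj₁ (stage m) ⊑ proj₁ (stage n)
      stage-mono ℕ.≤′-refl            = id
      stage-mono {m} {suc n} (ℕ.≤′-step m≤n) =
        proj₁ (proj₂ (decideAll (stage n) (enum n))) ∘ stage-mono m≤n

      stage-+ʳ : ∀ m n → proj₁ (stage m) ⊑ proj₁ (stage (m ℕ.+ n))
      stage-+ʳ m n = stage-mono (ℕ.≤⇒≤′ (ℕ.m≤m+n m n))

      stage-+ˡ : ∀ m n → proj₁ (stage n) ⊑ proj₁ (stage (m ℕ.+ n))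
      stage-+ˡ m n = stage-mono (ℕ.≤⇒≤′ (ℕ.m≤n+m n m))

    limit : Filter A
    limit = record
      { _∋_          = λ a → ∃[ n ] proj₁ (stage n) ∋ a
      ; ∋-⊤          = λ ⊤≤a → 0 , ⊤≤a
      ; modus-ponens = λ (m , f) (n , g) →
          m ℕ.+ n , modus-ponens (proj₁ (stage (m ℕ.+ n))) (stage-+ʳ m n f) (stage-+ˡ m n g)
      }

    limit-avoids : ¬ (limit ∋ d)
    limit-avoids (n , d∈Fₙ) = proj₂ (stage n) d∈Fₙ

    limit-prime : ∀ a b → limit ∋ (a ⇒ b) ⊎ limit ∋ (b ⇒ a)
    limit-prime a b with decides (a ⇒ b) | decides (b ⇒ a)
      where
      decides : ∀ p → Decides limit p
      decides p with enum-complete p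
      ... | n , p∈ = Decides-mono (proj₁ (stage (suc n))) limit (suc n ,_)
                       (proj₂ (proj₂ (decideAll (stage n) (enum n))) p∈)
    ... | inj₁ a⇒b∈  | _          = inj₁ a⇒b∈
    ... | inj₂ _     | inj₁ b⇒a∈  = inj₂ b⇒a∈
    ... | inj₂ d∈₁   | inj₂ d∈₂   = contradiction (extend-prelinear limit a b d∈₁ d∈₂) limit-avoids

-- One-generated subalgebras.

module Generated {c ℓ : Level} (A : Algebra c ℓ) (a : Algebra.Carrier A) where

  open Algebra A

  private
    value : Lift c UnaryTerm → Carrier
    value t = termFunction A (lower t) a

  -- Presenting the subalgebra by terms under equality of values makes its carrier enumerable
  -- whatever `A` is; `Lift` keeps it at the level of the algebras in `V`.
  generated : Algebra c ℓ
  generated = record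
    { Carrier       = Lift c UnaryTerm
    ; _≈_           = λ s t → value s ≈ value t
    ; _·_           = λ s t → lift (lower s ·ₜ lower t)
    ; _⇒_           = λ s t → lift (lower s ⇒ₜ lower t)
    ; ⊤             = lift ⊤ₜ
    ; isEquivalence = On.isEquivalence value isEquivalence
    ; ·-cong        = ·-cong
    ; ⇒-cong        = ⇒-cong
    }

  generator : Lift c UnaryTerm
  generator = lift (var zero)

  value-⟦⟧ : ∀ {x} {X : Set x} (t : Term X) ρ → value (Algebra.⟦_⟧ generated t ρ) ≡ ⟦ t ⟧ (value ∘ ρ)
  value-⟦⟧ (var i)  ρ = ≡.refl
  value-⟦⟧ (s ·ₜ t) ρ = ≡.cong₂ _·_ (value-⟦⟧ s ρ) (value-⟦⟧ t ρ)
  value-⟦⟧ (s ⇒ₜ t) ρ = ≡.cong₂ _⇒_ (value-⟦⟧ s ρ) (value-⟦⟧ t ρ)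
  value-⟦⟧ ⊤ₜ       ρ = ≡.refl

  generated-Mod : ∀ {e} (E : Rel (Term ℕ) e) → Mod E A → Mod E generated
  generated-Mod E A⊨E s t sEt ρ rewrite value-⟦⟧ s ρ | value-⟦⟧ t ρ = A⊨E s t sEt (value ∘ ρ)

  private
    terms : ℕ → List UnaryTerm
    terms zero    = []
    terms (suc n) = var zero ∷ ⊤ₜ ∷ cartesianProductWith _·ₜ_ (terms n) (terms n)
                                 ++ cartesianProductWith _⇒ₜ_ (terms n) (terms n)

    ∈-terms : ∀ t {n} → size t ℕ.≤ n → t ∈ terms n
    ∈-terms (var zero) (s≤s _) = here ≡.refl
    ∈-terms ⊤ₜ         (s≤s _) = there (here ≡.refl)
    ∈-terms (s ·ₜ t)   (s≤s ≤n) = there (there (∈-++⁺ˡ (∈-cartesianProductWith⁺ _·ₜ_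
      (∈-terms s (ℕ.m+n≤o⇒m≤o (size s) ≤n)) (∈-terms t (ℕ.m+n≤o⇒n≤o (size s) ≤n)))))
    ∈-terms (s ⇒ₜ t)   (s≤s ≤n) = there (there (∈-++⁺ʳ _ (∈-cartesianProductWith⁺ _⇒ₜ_
      (∈-terms s (ℕ.m+n≤o⇒m≤o (size s) ≤n)) (∈-terms t (ℕ.m+n≤o⇒n≤o (size s) ≤n)))))

  enum : ℕ → List (Lift c UnaryTerm)
  enum n = map lift (terms n)

  enum-complete : ∀ t → ∃[ n ] t ∈ enum n
  enum-complete (lift t) = size t , ∈-map⁺ lift (∈-terms t ℕ.≤-refl)

-- Finiteness from finitely many separating predicates.

-- A setoid is finite if finitely many predicates separate its elements; excluded
-- middle decides which of the finitely many cells are inhabited.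
separated⇒enumerable : (∀ {a : Level} → ExcludedMiddle a) →
  ∀ {a ℓ p q : Level} (S : Setoid a ℓ) (Q : Pred (Setoid.Carrier S) q)
  (Ps : List (Pred (Setoid.Carrier S) p)) →
  (∀ x y → Q x → Q y → All (λ P → (P x → P y) × (P y → P x)) Ps → Setoid._≈_ S x y) →
  ∃[ xs ] (∀ x → Q x → Any (Setoid._≈_ S x) xs)
separated⇒enumerable em S Q [] separates with em {P = ∃ Q}
... | yes (y , Qy) = y ∷ [] , λ x Qx → here (separates x y Qx Qy [])
... | no  ∄        = [] , λ x Qx → contradiction (x , Qx) ∄
separated⇒enumerable em S Q (P ∷ Ps) separates
  with separated⇒enumerable em S (λ x → Q x × P x) Ps
         (λ x y (Qx , Px) (Qy , Py) agree → separates x y Qx Qy (((λ _ → Py) , (λ _ → Px)) ∷ agree))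
     | separated⇒enumerable em S (λ x → Q x × ¬ P x) Ps
         (λ x y (Qx , ¬Px) (Qy , ¬Py) agree → separates x y Qx Qy
           (((λ Px → contradiction Px ¬Px) , (λ Py → contradiction Py ¬Py)) ∷ agree))
... | xs , xs-complete | ys , ys-complete = xs ++ ys , complete
  where
  complete : ∀ x → Q x → Any _ (xs ++ ys)
  complete x Qx with em {P = P x}
  ... | yes Px = Any.++⁺ˡ (xs-complete x (Qx , Px))
  ... | no ¬Px = Any.++⁺ʳ xs (ys-complete x (Qx , ¬Px))

-- Reduction to chains and enumeration of the conuclei.

module Subvariety (em : ∀ {a : Level} → ExcludedMiddle a) {c ℓ v e : Level}
  (V : Pred (Algebra c ℓ) v) (isVariety : IsVariety e V) (V⊆WH : V ⊆ IsWajsbergHoop) where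

  private
    E = proj₁ isVariety
    V⊆Mod = proj₁ (proj₂ isVariety)
    Mod⊆V = proj₂ (proj₂ isVariety)

  private
    ⟦⟧-unary : ∀ (A : Algebra c ℓ) t ρ → Algebra.⟦_⟧ A t ρ ≡ termFunction A t (ρ zero)
    ⟦⟧-unary A (var zero) ρ = ≡.refl
    ⟦⟧-unary A (s ·ₜ t)   ρ = ≡.cong₂ (Algebra._·_ A) (⟦⟧-unary A s ρ) (⟦⟧-unary A t ρ)
    ⟦⟧-unary A (s ⇒ₜ t)   ρ = ≡.cong₂ (Algebra._⇒_ A) (⟦⟧-unary A s ρ) (⟦⟧-unary A t ρ)
    ⟦⟧-unary A ⊤ₜ         ρ = ≡.refl

    termFunction-generator : ∀ (A : Algebra c ℓ) a t →
      termFunction (Generated.generated A a) t (Generated.generator A a) ≡ lift t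
    termFunction-generator A a (var zero) = ≡.refl
    termFunction-generator A a (s ·ₜ t)   =
      ≡.cong₂ (Algebra._·_ (Generated.generated A a)) (termFunction-generator A a s) (termFunction-generator A a t)
    termFunction-generator A a (s ⇒ₜ t)   =
      ≡.cong₂ (Algebra._⇒_ (Generated.generated A a)) (termFunction-generator A a s) (termFunction-generator A a t)
    termFunction-generator A a ⊤ₜ         = ≡.refl

  AgreeOnChains : (s t : UnaryTerm) → Set (lsuc (c ⊔ ℓ) ⊔ v)
  AgreeOnChains s t =
    ∀ C → V C → Total C → ∀ x → Algebra._≈_ C (termFunction C s x) (termFunction C t x)

  module _ {s t : UnaryTerm} (agree : AgreeOnChains s t) {A : Algebra c ℓ} (A∈V : V A)
           (a : Algebra.Carrier A) where

    open Generated A a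

    private
      generated∈V : V generated
      generated∈V = Mod⊆V (generated-Mod E (V⊆Mod A∈V))

      module A = WajsbergHoopProperties A (V⊆WH A∈V)
      open HoopFilters generated (IsWajsbergHoop.isHoop (V⊆WH generated∈V))

    agree-on-chains⇒≤ : Algebra._≤_ A (termFunction A s a) (termFunction A t a)
    agree-on-chains⇒≤ with em {P = Algebra._≤_ generated (lift ⊤ₜ) (lift (s ⇒ₜ t))}
    ... | yes ⊤≤s⇒t = A.⊤≤⇒≤ ⊤≤s⇒t
    ... | no  ⊤≰s⇒t = contradiction s⇒t∈F (PrimeFilter.limit-avoids em generated (V⊆WH generated∈V) ⊤≰s⇒t enum enum-complete)
      where
      open PrimeFilter em generated (V⊆WH generated∈V)
      F = limit ⊤≰s⇒t enum enum-complete
      C = quotient F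
      C∈V : V C
      C∈V = Mod⊆V (quotient-Mod F E (generated-Mod E (V⊆Mod A∈V)))
      C-total : Total C
      C-total = quotient-total F (limit-prime ⊤≰s⇒t enum enum-complete)
      value≡ : ∀ r → termFunction C r generator ≡ lift r
      value≡ r = ≡.trans (⟦⟧-quotient F r _) (termFunction-generator A a r)
      s⇒t∈F : F ∋ lift (s ⇒ₜ t)
      -- Equality in the quotient is membership of both implications in `F`, so agreement at the
      -- generator puts the avoided element into `F`.
      s⇒t∈F = ≡.subst₂ (λ x y → F ∋ Algebra._⇒_ generated x y) (value≡ s) (value≡ t)
        (proj₁ (agree C C∈V C-total generator))

  agree-on-chains⇒≈ : ∀ {s t} → AgreeOnChains s t → V ⊫ s ≈ t
  agree-on-chains⇒≈ {s} {t} agree A A∈V ρ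
    rewrite ⟦⟧-unary A s ρ | ⟦⟧-unary A t ρ =
    HoopProperties.≤-antisym A (IsWajsbergHoop.isHoop (V⊆WH A∈V))
      (agree-on-chains⇒≤ {s} {t} agree A∈V (ρ zero))
      (agree-on-chains⇒≤ {t} {s} (λ C C∈V total x →
        IsEquivalence.sym (Algebra.isEquivalence C) (agree C C∈V total x)) A∈V (ρ zero))

  module Chain (C : Algebra c ℓ) (C∈V : V C) (total : Total C) = WajsbergChain em C (V⊆WH C∈V) total

  BoundedChains : ℕ → Set (lsuc (c ⊔ ℓ) ⊔ v)
  BoundedChains n = ∀ C (C∈V : V C) (total : Total C) → Chain.Bounded C C∈V total n

  module _ (unbounded : ¬ ∃ BoundedChains) where

    private
      -- Were `P` false, no chain could contain a witness, so `n` would bound the index in all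
      -- chains of `V`.
      from-witness : ∀ n {P : Set} →
        (∀ C (C∈V : V C) (total : Total C) {x} → Chain.Nilpotent C C∈V total x →
          ¬ Chain.IsMin C C∈V total (Chain._^_ C C∈V total x n) → P) → P
      from-witness n {P} witness⇒P with em {P = P}
      ... | yes p = p
      ... | no ¬p = contradiction (n , λ C C∈V total y y-nilp →
        decidable-stable em (λ ¬min → ¬p (witness⇒P C C∈V total y-nilp ¬min))) unbounded

    unbounded⇒evalC≡neg1 : ∀ t → DefinesMultiplicativeConucleus V t → evalC t ≡ neg 1
    unbounded⇒evalC≡neg1 t conucleus = from-witness (suc (size t)) λ C C∈V total x-nilp →
      Chain.unbounded⇒evalC≡neg1 C C∈V total t (conucleus C C∈V) x-nilp

    unbounded⇒evalŁ≡1 : ∀ t → DefinesMultiplicativeConucleus V t → ∀ m → evalŁ (2 ℕ.+ m) t ≡ 1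
    unbounded⇒evalŁ≡1 t conucleus m = from-witness (suc ((2 ℕ.+ m) ℕ.* size t) ℕ.* (2 ℕ.+ m)) λ C C∈V total x-nilp →
      Chain.unbounded⇒evalŁ≡1 C C∈V total t (conucleus C C∈V) x-nilp m

  conuclei-enumerable : ∃[ ts ] IsEnumeration (conucleusTerms V) ts
  conuclei-enumerable with em {P = ∃ BoundedChains}
  ... | yes (n , bounded) = Product.map₂ (λ complete x → complete x tt)
    (separated⇒enumerable em (conucleusTerms V) (λ _ → Unit) (chang ∷ map łukasiewicz (upTo n)) separates)
    where
    chang : Pred (Setoid.Carrier (conucleusTerms V)) _
    chang (t , _) = evalC t ≡ neg 1
    łukasiewicz : ℕ → Pred (Setoid.Carrier (conucleusTerms V)) _
    łukasiewicz m (t , _) = evalŁ (2 ℕ.+ m) t ≡ 1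
    separates : ∀ x y → Unit → Unit →
      All (λ P → (P x → P y) × (P y → P x)) (chang ∷ map łukasiewicz (upTo n)) →
      Setoid._≈_ (conucleusTerms V) x y
    separates (s , s-conucleus) (t , t-conucleus) _ _ (agreeC ∷ agreeŁ) =
      agree-on-chains⇒≈ {s} {t} λ C C∈V total →
        let open Chain C C∈V total
            -- This is why the tests from `upTo n` suffice: for `n ≤ m` the common bound `n` already
            -- yields `Bounded (suc m)`.
            m<n : ∀ m → ¬ Bounded (suc m) → m ℕ.< n
            m<n m unbounded = ℕ.≰⇒> λ n≤m → unbounded λ y y-nilp →
              IsMin-down (^-anti y (ℕ.m≤n⇒m≤1+n n≤m)) (bounded C C∈V total y y-nilp)
            agree = λ m unbounded → All.lookup agreeŁ (∈-map⁺ łukasiewicz (∈-upTo⁺ (m<n m unbounded)))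
        in agree⇒≈ s t (s-conucleus C C∈V) (t-conucleus C C∈V) (proj₁ agreeC) (proj₂ agreeC)
             (λ m unbounded → proj₁ (agree m unbounded)) (λ m unbounded → proj₂ (agree m unbounded))
  ... | no  unbounded     = Product.map₂ (λ complete x → complete x tt)
    -- With unbounded indices all conuclei take the same reference values, so no separating
    -- predicate is needed and at most one class arises.
    (separated⇒enumerable em {p = Level.zero} (conucleusTerms V) (λ _ → Unit) [] separates)
    where
    separates : ∀ x y → Unit → Unit → All _ [] → Setoid._≈_ (conucleusTerms V) x y
    separates (s , s-conucleus) (t , t-conucleus) _ _ _ =
      agree-on-chains⇒≈ {s} {t} λ C C∈V total → Chain.agree⇒≈ C C∈V total s t (s-conucleus C C∈V) (t-conucleus C C∈V)
        (λ _ → unbounded⇒evalC≡neg1 unbounded t t-conucleus)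
        (λ _ → unbounded⇒evalC≡neg1 unbounded s s-conucleus)
        (λ m _ _ → unbounded⇒evalŁ≡1 unbounded t t-conucleus m)
        (λ m _ _ → unbounded⇒evalŁ≡1 unbounded s s-conucleus m)

corollary5p9 : (∀ {a : Level} → ExcludedMiddle a) →
    ∀ {c ℓ v e : Level} (V : Pred (Algebra c ℓ) v) → IsVariety e V → V ⊆ IsWajsbergHoop →
    ∃[ ts ] IsEnumeration (conucleusTerms V) ts
corollary5p9 em V isVariety V⊆WH = Subvariety.conuclei-enumerable em V isVariety V⊆WH
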